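{- For all integers $n_1,n_2\ge 0$ the Al-Salam-Chihara polynomials $Q_n(x)=Q_n(x;\alpha,\beta|q)$ satisfy $$Q_{n_1}(x)Q_{n_2}(x)=\sum_{n_3\ge 0}C_{n_1,n_2}^{n_3}(\alpha,\beta;q)\,Q_{n_3}(x),$$ where $$C_{n_1,n_2}^{n_3}(\alpha,\beta;q)=(-1)^{n_1+n_2+n_3}\frac{(q;q)_{n_1}(q;q)_{n_2}}{(\alpha\beta;q)_{n_3}}\sum_{m_2,m_3}\frac{(\alpha\beta;q)_{n_1+m_3}\,\alpha^{m_2}\,\beta^{\,n_3+n_2-n_1-m_2-2m_3}\,q^{\binom{m_2}{2}+\binom{n_3+n_2-n_1-m_2-2m_3}{2}}}{(q;q)_{n_3+n_2-n_1-m_2-2m_3}\,(q;q)_{m_2}\,(q;q)_{m_3+n_1-n_3}\,(q;q)_{m_3+n_1-n_2}\,(q;q)_{m_3}},$$ the inner sum being over all integers $m_2,m_3$ such that $m_2$, $m_3$, $n_3+n_2-n_1-m_2-2m_3$, $m_3+n_1-n_3$ and $m_3+n_1-n_2$ are all nonnegative.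
   Context: The Al-Salam-Chihara polynomials $Q_n(x)=Q_n(x;\alpha,\beta|q)$ are defined by $Q_{ -1}(x)=0$, $Q_0(x)=1$ and $$Q_{n+1}(x)=(2x-(\alpha+\beta)q^n)Q_n(x)-(1-q^n)(1-\alpha\beta q^{n-1})Q_{n-1}(x),\qquad n\ge 0.$$ Here $(a;q)_0=1$ and $(a;q)_n=\prod_{j=0}^{n-1}(1-aq^j)$. The parameters $\alpha,\beta,q$ are generic (or indeterminates), so that the denominators do not vanish. -}

module Defs where

open import Algebra.Bundles using (CommutativeRing)
open import Level using (_⊔_)
open import Data.Bool.Base using (if_then_else_)
open import Data.Fin.Base using (toℕ)
open import Data.Nat.Base as ℕ using (ℕ; zero; suc; _∸_; _≤_)
open import Data.Nat.Combinatorics using (_C_)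
open import Data.Nat.Properties using (_≤?_)
open import Data.Product.Base using (∃-syntax; _×_; proj₁)
open import Relation.Nullary.Decidable.Core using (Dec; does; _×-dec_)

module AlSalamChihara {c ℓ} (R : CommutativeRing c ℓ) where

  open CommutativeRing R
  open import Algebra.Definitions _≈_ using (Invertible)
  open import Algebra.Properties.Semiring.Exp semiring using (_^_)
  open import Algebra.Properties.Semiring.Sum semiring using (sum-syntax)

  -- The q-Pochhammer symbol (a;q)ₙ.
  ⟨_⨾_⟩ : Carrier → Carrier → ℕ → Carrier
  ⟨ a ⨾ q ⟩ zero    = 1#
  ⟨ a ⨾ q ⟩ (suc n) = ⟨ a ⨾ q ⟩ n * (1# - a * q ^ n)

  -- The case n = 1 is the three-term recurrence started from Q₋₁ = 0, Q₀ = 1.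
  Q : (α β q x : Carrier) → ℕ → Carrier
  Q α β q x zero          = 1#
  Q α β q x (suc zero)    = (x + x) - (α + β)
  Q α β q x (suc (suc n)) =
      ((x + x) - (α + β) * q ^ suc n) * Q α β q x (suc n)
    - (1# - q ^ suc n) * (1# - α * β * q ^ n) * Q α β q x n

  -- Genericity of the parameters: every denominator that can occur in the
  -- linearization coefficients is a unit.  Over a field this says that none
  -- of them vanishes; it also covers indeterminate parameters, and R may be a
  -- polynomial ring in x over the coefficients.
  record Generic (α β q : Carrier) : Set (c ⊔ ℓ) where
    field
      q-invertible  : ∀ n → Invertible 1# _*_ (⟨ q ⨾ q ⟩ n)
      αβ-invertible : ∀ n → Invertible 1# _*_ (⟨ α * β ⨾ q ⟩ n)

    1/⟨q⨾q⟩ : ℕ → Carrier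
    1/⟨q⨾q⟩ n = proj₁ (q-invertible n)

    1/⟨αβ⨾q⟩ : ℕ → Carrier
    1/⟨αβ⨾q⟩ n = proj₁ (αβ-invertible n)

  -- Nonnegativity of n₃ + n₂ - n₁ - m₂ - 2m₃, m₃ + n₁ - n₃ and m₃ + n₁ - n₂,
  -- with the negative terms moved across so that it can be said in ℕ.
  Admissible : (n₁ n₂ n₃ m₂ m₃ : ℕ) → Set
  Admissible n₁ n₂ n₃ m₂ m₃ =
      (n₁ ℕ.+ m₂ ℕ.+ 2 ℕ.* m₃ ≤ n₃ ℕ.+ n₂)
    × (n₃ ≤ m₃ ℕ.+ n₁)
    × (n₂ ≤ m₃ ℕ.+ n₁)

  admissible? : ∀ n₁ n₂ n₃ m₂ m₃ → Dec (Admissible n₁ n₂ n₃ m₂ m₃)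
  admissible? n₁ n₂ n₃ m₂ m₃ =
      (n₁ ℕ.+ m₂ ℕ.+ 2 ℕ.* m₃ ≤? n₃ ℕ.+ n₂)
    ×-dec (n₃ ≤? m₃ ℕ.+ n₁)
    ×-dec (n₂ ≤? m₃ ℕ.+ n₁)

  module _ {α β q : Carrier} (generic : Generic α β q) where

    open Generic generic

    -- Only used for admissible indices, where no truncation occurs in _∸_.
    term : (n₁ n₂ n₃ m₂ m₃ : ℕ) → Carrier
    term n₁ n₂ n₃ m₂ m₃ =
        ⟨ α * β ⨾ q ⟩ (n₁ ℕ.+ m₃) * α ^ m₂ * β ^ e * q ^ (m₂ C 2 ℕ.+ e C 2)
      * ( 1/⟨q⨾q⟩ e
        * 1/⟨q⨾q⟩ m₂
        * 1/⟨q⨾q⟩ (m₃ ℕ.+ n₁ ∸ n₃)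
        * 1/⟨q⨾q⟩ (m₃ ℕ.+ n₁ ∸ n₂)
        * 1/⟨q⨾q⟩ m₃
        )
      where
      e : ℕ
      e = n₃ ℕ.+ n₂ ∸ (n₁ ℕ.+ m₂ ℕ.+ 2 ℕ.* m₃)

    -- Admissibility forces m₂ ≤ n₃ + n₂ and m₃ ≤ n₃ + n₂, so the box below
    -- contains every admissible pair.
    coefficient : (n₁ n₂ n₃ : ℕ) → Carrier
    coefficient n₁ n₂ n₃ =
        (- 1#) ^ (n₁ ℕ.+ n₂ ℕ.+ n₃)
      * (⟨ q ⨾ q ⟩ n₁ * ⟨ q ⨾ q ⟩ n₂ * 1/⟨αβ⨾q⟩ n₃)
      * (∑[ i < suc (n₃ ℕ.+ n₂) ] ∑[ j < suc (n₃ ℕ.+ n₂) ]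
          (if does (admissible? n₁ n₂ n₃ (toℕ i) (toℕ j))
           then term n₁ n₂ n₃ (toℕ i) (toℕ j)
           else 0#))

  -- The sum of f over all of ℕ is s, all but finitely many terms being zero.
  HasFiniteSum : (ℕ → Carrier) → Carrier → Set ℓ
  HasFiniteSum f s =
    ∃[ N ] (∀ n → N ≤ n → f n ≈ 0#) × (∑[ i < N ] f (toℕ i)) ≈ s

{-# OPTIONS --safe #-}
module Submission where

open import Defs
open import Algebra.Bundles using (CommutativeRing)
open import Algebra.Solver.Ring.AlmostCommutativeRing
  using (fromCommutativeRing; _-Raw-AlmostCommutative⟶_)
open import Data.Bool.Base using (if_then_else_)
open import Data.Fin.Base using (toℕ)
open import Data.Integer.Base as ℤ using (ℤ; +_; -[1+_]; +[1+_]; _⊖_; _◃_)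
import Data.Integer.Properties as ℤ
import Data.Maybe.Base as Maybe
open import Data.Nat.Base as ℕ using (ℕ; zero; suc; _∸_; _≤_; _<_; z≤n; s≤s)
open import Data.Nat.Combinatorics using (_C_; nC1≡n; nCk+nC[k+1]≡[n+1]C[k+1])
import Data.Nat.Properties as ℕ
open import Data.Nat.Solver using (module +-*-Solver)
open import Data.Product.Base using (_×_; _,_; proj₁; proj₂)
import Data.Sign.Base as Sign
open import Function.Base using (_∘_)
open import Relation.Binary.PropositionalEquality.Core as ≡ using (_≡_; _≢_)
open import Relation.Nullary.Decidable using (yes; no; does; dec-true; dec-false; dec⇒maybe)
open import Relation.Nullary.Negation using (¬_; contradiction)

-- Put p = αβ, M = n₁ + m₃ and h_k = Σ_{i+j=k} αⁱ βʲ q^(C(i,2)+C(j,2)) / ((q;q)_i (q;q)_j).  Up to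
-- normalising factors the coefficient is
--   S(n₁,n₂,n₃) = Σ_M (p;q)_M h_{n₁+n₂+n₃-2M} / ((q;q)_{M-n₁} (q;q)_{M-n₂} (q;q)_{M-n₃}),
-- which is symmetric.  Since h is a coefficient of (-αt;q)_∞ (-βt;q)_∞, it satisfies
-- (1-q^{k+1}) h_{k+1} = (α+β) q^k h_k + p q^{k-1} h_{k-1}.  With this the three-term operator in n₁
-- that has (-1)ⁿ Qₙ / (q;q)ₙ as eigenvector turns S, up to a telescoping sum over M, into an
-- expression that is still symmetric.  So it agrees on S with the same operator in n₃, whose adjoint
-- has (-1)ⁿ Qₙ / (αβ;q)ₙ as eigenvector.  Hence both sides of the linearization formula satisfy one
-- three-term recurrence in n₁, and they agree at n₁ = 0 because S(0,n₂,n₃) is diagonal.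

open +-*-Solver using () renaming
  (solve to solveℕ; _:+_ to _⊕_; _:*_ to _⊗_; _:=_ to _⊜_; con to κ)

m+m≡m*2 : ∀ m → m ℕ.+ m ≡ m ℕ.* 2
m+m≡m*2 = solveℕ 1 (λ m → m ⊕ m ⊜ m ⊗ κ 2) ≡.refl

reverse-sum : ∀ a b c → a ℕ.+ b ℕ.+ c ≡ c ℕ.+ b ℕ.+ a
reverse-sum = solveℕ 3 (λ a b c → a ⊕ b ⊕ c ⊜ c ⊕ b ⊕ a) ≡.refl

-- A ring solver with integer coefficients.

module IntegerCoefficients {c ℓ} (R : CommutativeRing c ℓ) where
  open CommutativeRing R
  open import Algebra.Properties.AbelianGroup +-abelianGroup
    using (⁻¹-∙-comm; ⁻¹-involutive; ε⁻¹≈ε)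
  open import Algebra.Properties.Ring ring using (-‿distribˡ-*; -‿distribʳ-*)
  open import Algebra.Properties.Semiring.Mult.TCOptimised semiring
    using (×-homo-+; ×1-homo-*) renaming (_×_ to _·_)
  open import Algebra.Properties.CommutativeSemigroup +-commutativeSemigroup
    using (interchange)
  open import Relation.Binary.Reasoning.Setoid setoid

  fromℤ : ℤ → Carrier
  fromℤ (+ n)    = n · 1#
  fromℤ -[1+ n ] = - (suc n · 1#)

  fromℤ-⊖ : ∀ m n → fromℤ (m ⊖ n) ≈ m · 1# - n · 1#
  fromℤ-⊖ zero    zero    = sym (-‿inverseʳ 0#)
  fromℤ-⊖ zero    (suc n) = sym (+-identityˡ _)
  fromℤ-⊖ (suc m) zero    = sym (trans (+-congˡ ε⁻¹≈ε) (+-identityʳ _))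
  fromℤ-⊖ (suc m) (suc n) = begin
    fromℤ (suc m ⊖ suc n)                  ≡⟨ ≡.cong fromℤ (ℤ.[1+m]⊖[1+n]≡m⊖n m n) ⟩
    fromℤ (m ⊖ n)                          ≈⟨ fromℤ-⊖ m n ⟩
    m · 1# - n · 1#                        ≈⟨ +-identityˡ _ ⟨
    0# + (m · 1# - n · 1#)                 ≈⟨ +-congʳ (-‿inverseʳ 1#) ⟨
    (1# - 1#) + (m · 1# - n · 1#)          ≈⟨ interchange _ _ _ _ ⟩
    (1# + m · 1#) + (- 1# + - (n · 1#))    ≈⟨ +-congˡ (⁻¹-∙-comm _ _) ⟩
    (1# + m · 1#) - (1# + n · 1#)          ≈⟨ +-cong (×-homo-+ 1# 1 m) (-‿cong (×-homo-+ 1# 1 n)) ⟨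
    suc m · 1# - suc n · 1#                ∎

  fromℤ-+ : ∀ i j → fromℤ (i ℤ.+ j) ≈ fromℤ i + fromℤ j
  fromℤ-+ (+ m)    (+ n)    = ×-homo-+ 1# m n
  fromℤ-+ (+ m)    -[1+ n ] = fromℤ-⊖ m (suc n)
  fromℤ-+ -[1+ m ] (+ n)    = trans (fromℤ-⊖ n (suc m)) (+-comm _ _)
  fromℤ-+ -[1+ m ] -[1+ n ] = begin
    - (suc (suc (m ℕ.+ n)) · 1#)         ≡⟨ ≡.cong (λ k → - (suc k · 1#)) (ℕ.+-suc m n) ⟨
    - ((suc m ℕ.+ suc n) · 1#)           ≈⟨ -‿cong (×-homo-+ 1# (suc m) (suc n)) ⟩
    - (suc m · 1# + suc n · 1#)          ≈⟨ ⁻¹-∙-comm _ _ ⟨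
    - (suc m · 1#) + - (suc n · 1#)      ∎

  fromℤ-neg : ∀ i → fromℤ (ℤ.- i) ≈ - fromℤ i
  fromℤ-neg (+ zero)  = sym ε⁻¹≈ε
  fromℤ-neg +[1+ n ]  = refl
  fromℤ-neg -[1+ n ]  = sym (⁻¹-involutive _)

  fromℤ-neg◃ : ∀ n → fromℤ (Sign.- ◃ n) ≈ - (n · 1#)
  fromℤ-neg◃ zero    = sym ε⁻¹≈ε
  fromℤ-neg◃ (suc n) = refl

  fromℤ-pos◃ : ∀ n → fromℤ (Sign.+ ◃ n) ≈ n · 1#
  fromℤ-pos◃ zero    = refl
  fromℤ-pos◃ (suc n) = refl

  fromℤ-* : ∀ i j → fromℤ (i ℤ.* j) ≈ fromℤ i * fromℤ j
  fromℤ-* (+ m)    (+ n)    = trans (fromℤ-pos◃ (m ℕ.* n)) (×1-homo-* m n)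
  fromℤ-* (+ m)    -[1+ n ] = trans (fromℤ-neg◃ (m ℕ.* suc n))
    (trans (-‿cong (×1-homo-* m (suc n))) (-‿distribʳ-* _ _))
  fromℤ-* -[1+ m ] (+ n)    = trans (fromℤ-neg◃ (suc m ℕ.* n))
    (trans (-‿cong (×1-homo-* (suc m) n)) (-‿distribˡ-* _ _))
  fromℤ-* -[1+ m ] -[1+ n ] = begin
    (suc m ℕ.* suc n) · 1#             ≈⟨ ×1-homo-* (suc m) (suc n) ⟩
    suc m · 1# * suc n · 1#            ≈⟨ ⁻¹-involutive _ ⟨
    - - (suc m · 1# * suc n · 1#)      ≈⟨ -‿cong (-‿distribˡ-* _ _) ⟩
    - (- (suc m · 1#) * suc n · 1#)    ≈⟨ -‿distribʳ-* _ _ ⟩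
    - (suc m · 1#) * - (suc n · 1#)    ∎

  -- Integer coefficients, whose equality is decidable, let the solver cancel terms.
  morphism : ℤ.+-*-rawRing -Raw-AlmostCommutative⟶ fromCommutativeRing R
  morphism = record
    { ⟦_⟧    = fromℤ
    ; +-homo = fromℤ-+
    ; *-homo = fromℤ-*
    ; -‿homo = fromℤ-neg
    ; 0-homo = refl
    ; 1-homo = refl
    }

  open import Algebra.Solver.Ring ℤ.+-*-rawRing (fromCommutativeRing R) morphism
    (λ i j → Maybe.map (λ i≡j → reflexive (≡.cong fromℤ i≡j)) (dec⇒maybe (i ℤ.≟ j)))
    public using (solve; con; _:=_; _:+_; _:*_; _:-_; :-_; Polynomial)

  𝟏 : ∀ {n} → Polynomial n
  𝟏 = con (+ 1)

  𝟎 : ∀ {n} → Polynomial n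
  𝟎 = con (+ 0)


-- Finite sums over initial segments of ℕ.

module FiniteSums {c ℓ} (R : CommutativeRing c ℓ) where
  open CommutativeRing R
  open import Algebra.Properties.Semiring.Sum semiring
    using (sum; sum-cong-≋; sum-replicate-zero; ∑-distrib-+; ∑-comm; *-distribˡ-sum)
  open import Relation.Binary.Reasoning.Setoid setoid

  opaque
    -- Opaque, so that `Σ< n f` stays a rigid term from which unification can read off `n` and `f`.
    Σ< : ℕ → (ℕ → Carrier) → Carrier
    Σ< n f = sum {n} (λ i → f (toℕ i))

    Σ-def : ∀ n f → sum {n} (λ i → f (toℕ i)) ≡ Σ< n f
    Σ-def n f = ≡.refl

    Σ-suc : ∀ n f → Σ< (suc n) f ≡ f 0 + Σ< n (f ∘ suc)
    Σ-suc n f = ≡.refl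

    Σ-cong : ∀ n {f g} → (∀ i → f i ≈ g i) → Σ< n f ≈ Σ< n g
    Σ-cong n f≈g = sum-cong-≋ {n} (λ i → f≈g (toℕ i))

    Σ-zero : ∀ n {f} → (∀ i → f i ≈ 0#) → Σ< n f ≈ 0#
    Σ-zero n f≈0 = trans (Σ-cong n f≈0) (sum-replicate-zero n)

    Σ-+ : ∀ n f g → Σ< n (λ i → f i + g i) ≈ Σ< n f + Σ< n g
    Σ-+ n f g = ∑-distrib-+ {n} (λ i → f (toℕ i)) (λ i → g (toℕ i))

    -- The left side uses `sum` in order to match the double sum inside `coefficient`.
    Σ-comm : ∀ m n (f : ℕ → ℕ → Carrier) →
      sum {m} (λ i → sum {n} (λ j → f (toℕ i) (toℕ j))) ≈ Σ< n (λ j → Σ< m (λ i → f i j))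
    Σ-comm m n f = ∑-comm {m} {n} (λ i j → f (toℕ i) (toℕ j))

    Σ-*ˡ : ∀ n x f → Σ< n (λ i → x * f i) ≈ x * Σ< n f
    Σ-*ˡ n x f = sym (*-distribˡ-sum {n} x (λ i → f (toℕ i)))

    Σ-last : ∀ n f → Σ< (suc n) f ≈ Σ< n f + f n
    Σ-last zero    f = +-comm _ _
    Σ-last (suc n) f = trans (+-congˡ (Σ-last n (f ∘ suc))) (sym (+-assoc _ _ _))

    -- Serves both the telescoping over M and the summation by parts: moving the index by one only
    -- exchanges the two boundary values.
    Σ-shift : ∀ n f → f 0 ≈ 0# → f n ≈ 0# → Σ< n (f ∘ suc) ≈ Σ< n f
    Σ-shift n f f0≈0 fn≈0 = begin
      Σ< n (f ∘ suc)          ≈⟨ +-identityˡ _ ⟨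
      0# + Σ< n (f ∘ suc)     ≈⟨ +-congʳ f0≈0 ⟨
      f 0 + Σ< n (f ∘ suc)    ≈⟨ Σ-last n f ⟩
      Σ< n f + f n            ≈⟨ +-congˡ fn≈0 ⟩
      Σ< n f + 0#             ≈⟨ +-identityʳ _ ⟩
      Σ< n f                  ∎

    Σ-truncate : ∀ {m n} f → m ≤ n → (∀ i → m ≤ i → f i ≈ 0#) → Σ< n f ≈ Σ< m f
    Σ-truncate {n = n} f z≤n       f≈0 = Σ-zero n (λ i → f≈0 i z≤n)
    Σ-truncate         f (s≤s m≤n) f≈0 =
      +-congˡ (Σ-truncate (f ∘ suc) m≤n (λ i m≤i → f≈0 (suc i) (s≤s m≤i)))

    Σ-drop : ∀ m n f → (∀ i → i < m → f i ≈ 0#) → Σ< (m ℕ.+ n) f ≈ Σ< n (λ i → f (m ℕ.+ i))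
    Σ-drop zero    n f f≈0 = refl
    Σ-drop (suc m) n f f≈0 = begin
      f 0 + Σ< (m ℕ.+ n) (f ∘ suc)        ≈⟨ +-congʳ (f≈0 0 (s≤s z≤n)) ⟩
      0# + Σ< (m ℕ.+ n) (f ∘ suc)         ≈⟨ +-identityˡ _ ⟩
      Σ< (m ℕ.+ n) (f ∘ suc)              ≈⟨ Σ-drop m n (f ∘ suc) (λ i i<m → f≈0 (suc i) (s≤s i<m)) ⟩
      Σ< n (λ i → f (suc (m ℕ.+ i)))      ∎

    Σ-single : ∀ {k n} f → k < n → (∀ i → i ≢ k → f i ≈ 0#) → Σ< n f ≈ f k
    Σ-single {zero}  {suc n} f _         f≈0 =
      trans (+-congˡ (Σ-zero n (λ i → f≈0 (suc i) (λ ())))) (+-identityʳ _)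
    Σ-single {suc k} {suc n} f (s≤s k<n) f≈0 = begin
      f 0 + Σ< n (f ∘ suc)    ≈⟨ +-congʳ (f≈0 0 (λ ())) ⟩
      0# + Σ< n (f ∘ suc)     ≈⟨ +-identityˡ _ ⟩
      Σ< n (f ∘ suc)          ≈⟨ Σ-single (f ∘ suc) k<n (λ i i≢k → f≈0 (suc i) (i≢k ∘ ℕ.suc-injective)) ⟩
      f (suc k)               ∎

-- Sequences extended by zero to negative indices, and Cauchy products.

module Shift {c ℓ} (R : CommutativeRing c ℓ) where
  open CommutativeRing R
  open FiniteSums R
  open import Relation.Binary.Reasoning.Setoid setoid

  -- This is f at the integer m - n, with value 0 when m < n. It encodes the convention that
  -- 1/(q;q)_k and h_k vanish for k < 0.
  shift : (ℕ → Carrier) → ℕ → ℕ → Carrier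
  shift f m       zero    = f m
  shift f zero    (suc n) = 0#
  shift f (suc m) (suc n) = shift f m n

  shift-≤ : ∀ f {m n} → n ≤ m → shift f m n ≡ f (m ∸ n)
  shift-≤ f z≤n       = ≡.refl
  shift-≤ f (s≤s n≤m) = shift-≤ f n≤m

  shift-< : ∀ f {m n} → m < n → shift f m n ≡ 0#
  shift-< f {zero}  (s≤s _)   = ≡.refl
  shift-< f {suc m} (s≤s m<n) = shift-< f m<n

  shift-cancel : ∀ f k m n → shift f (k ℕ.+ m) (k ℕ.+ n) ≡ shift f m n
  shift-cancel f zero    m n = ≡.refl
  shift-cancel f (suc k) m n = shift-cancel f k m n

  shift-cong : ∀ {f g} m n → (∀ i → f i ≈ g i) → shift f m n ≈ shift g m n
  shift-cong m       zero    f≈g = f≈g m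
  shift-cong zero    (suc n) f≈g = refl
  shift-cong (suc m) (suc n) f≈g = shift-cong m n f≈g

  shift-+ : ∀ f g m n → shift (λ i → f i + g i) m n ≈ shift f m n + shift g m n
  shift-+ f g m       zero    = refl
  shift-+ f g zero    (suc n) = sym (+-identityˡ _)
  shift-+ f g (suc m) (suc n) = shift-+ f g m n

  shift-* : ∀ x f m n → shift (λ i → x * f i) m n ≈ x * shift f m n
  shift-* x f m       zero    = refl
  shift-* x f zero    (suc n) = sym (zeroʳ x)
  shift-* x f (suc m) (suc n) = shift-* x f m n

  -- Off the support both sides are zero. Hence identities between powers of q need checking only
  -- where truncated subtraction is genuine.
  on-support : ∀ f m n {x y} → (n ≤ m → x ≈ y) → x * shift f m n ≈ y * shift f m n
  on-support f m n {x} {y} x≈y with n ℕ.≤? m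
  ... | yes n≤m = *-congʳ (x≈y n≤m)
  ... | no  n≰m = begin
    x * shift f m n   ≈⟨ *-congˡ vanishes ⟩
    x * 0#            ≈⟨ zeroʳ x ⟩
    0#                ≈⟨ zeroʳ y ⟨
    y * 0#            ≈⟨ *-congˡ vanishes ⟨
    y * shift f m n   ∎
    where vanishes = reflexive (shift-< f (ℕ.≰⇒> n≰m))

  conv : (f g : ℕ → Carrier) → ℕ → Carrier
  conv f g k = Σ< (suc k) (λ i → f i * shift g k i)

  conv-cong : ∀ {f f′ g g′} k → (∀ i → f i ≈ f′ i) → (∀ j → g j ≈ g′ j) → conv f g k ≈ conv f′ g′ k
  conv-cong k f≈f′ g≈g′ = Σ-cong (suc k) (λ i → *-cong (f≈f′ i) (shift-cong k i g≈g′))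

  conv-+ˡ : ∀ f f′ g k → conv (λ i → f i + f′ i) g k ≈ conv f g k + conv f′ g k
  conv-+ˡ f f′ g k = trans (Σ-cong (suc k) (λ i → distribʳ _ _ _)) (Σ-+ (suc k) _ _)

  conv-+ʳ : ∀ f g g′ k → conv f (λ j → g j + g′ j) k ≈ conv f g k + conv f g′ k
  conv-+ʳ f g g′ k = trans
    (Σ-cong (suc k) (λ i → trans (*-congˡ (shift-+ g g′ k i)) (distribˡ _ _ _)))
    (Σ-+ (suc k) _ _)

  conv-*ˡ : ∀ x f g k → conv (λ i → x * f i) g k ≈ x * conv f g k
  conv-*ˡ x f g k = trans (Σ-cong (suc k) (λ i → *-assoc _ _ _)) (Σ-*ˡ (suc k) x _)

  conv-*ʳ : ∀ x f g k → conv f (λ j → x * g j) k ≈ x * conv f g k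
  conv-*ʳ x f g k = trans (Σ-cong (suc k) step) (Σ-*ˡ (suc k) x _)
    where
    step : ∀ i → f i * shift (λ j → x * g j) k i ≈ x * (f i * shift g k i)
    step i = begin
      f i * shift (λ j → x * g j) k i    ≈⟨ *-congˡ (shift-* x g k i) ⟩
      f i * (x * shift g k i)            ≈⟨ *-assoc _ _ _ ⟨
      f i * x * shift g k i              ≈⟨ *-congʳ (*-comm _ _) ⟩
      x * f i * shift g k i              ≈⟨ *-assoc _ _ _ ⟩
      x * (f i * shift g k i)            ∎

  conv-zero : ∀ f g → conv f g 0 ≈ f 0 * g 0
  conv-zero f g = trans (reflexive (Σ-suc 0 _))
    (trans (+-congˡ (Σ-zero 0 (λ _ → zeroʳ _))) (+-identityʳ _))

  conv-suc : ∀ f g k → conv f g (suc k) ≈ f 0 * g (suc k) + conv (f ∘ suc) g k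
  conv-suc f g k = reflexive (Σ-suc (suc k) _)

  -- In generating functions: a factor without constant term can be divided by t.
  conv-tailˡ : ∀ f g k → f 0 ≈ 0# → conv f g (suc k) ≈ conv (f ∘ suc) g k
  conv-tailˡ f g k f0≈0 = begin
    conv f g (suc k)                          ≈⟨ conv-suc f g k ⟩
    f 0 * g (suc k) + conv (f ∘ suc) g k      ≈⟨ +-congʳ (trans (*-congʳ f0≈0) (zeroˡ _)) ⟩
    0# + conv (f ∘ suc) g k                   ≈⟨ +-identityˡ _ ⟩
    conv (f ∘ suc) g k                        ∎

  conv-tailʳ : ∀ f g k → g 0 ≈ 0# → conv f g (suc k) ≈ conv f (g ∘ suc) k
  conv-tailʳ f g zero    g0≈0 = begin
    conv f g 1                          ≈⟨ conv-suc f g 0 ⟩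
    f 0 * g 1 + conv (f ∘ suc) g 0      ≈⟨ +-congˡ (conv-zero (f ∘ suc) g) ⟩
    f 0 * g 1 + f 1 * g 0               ≈⟨ +-congˡ (trans (*-congˡ g0≈0) (zeroʳ _)) ⟩
    f 0 * g 1 + 0#                      ≈⟨ +-identityʳ _ ⟩
    f 0 * g 1                           ≈⟨ conv-zero f (g ∘ suc) ⟨
    conv f (g ∘ suc) 0                  ∎
  conv-tailʳ f g (suc k) g0≈0 = begin
    conv f g (suc (suc k))                                  ≈⟨ conv-suc f g (suc k) ⟩
    f 0 * g (suc (suc k)) + conv (f ∘ suc) g (suc k)        ≈⟨ +-congˡ (conv-tailʳ (f ∘ suc) g k g0≈0) ⟩
    f 0 * g (suc (suc k)) + conv (f ∘ suc) (g ∘ suc) k      ≈⟨ conv-suc f (g ∘ suc) k ⟨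
    conv f (g ∘ suc) (suc k)                                ∎

  conv-extend : ∀ f g {k n} → k < n → Σ< n (λ i → f i * shift g k i) ≈ conv f g k
  conv-extend f g {k} k<n = Σ-truncate _ k<n
    (λ i k<i → trans (*-congˡ (reflexive (shift-< g k<i))) (zeroʳ _))

-- Generating functions: the coefficients of (-zt;q)_∞.

module Linearization {c ℓ} (R : CommutativeRing c ℓ) where
  open CommutativeRing R
  open AlSalamChihara R
  open IntegerCoefficients R
  open FiniteSums R
  open Shift R
  open import Algebra.Properties.Semiring.Exp semiring using (_^_; ^-homo-*; ^-congʳ)
  open import Relation.Binary.Reasoning.Setoid setoid

  -- Replacing t by qt in both generating functions replaces t by qt in their product.
  conv-geometric : ∀ q f g k → conv (λ i → q ^ i * f i) (λ j → q ^ j * g j) k ≈ q ^ k * conv f g k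
  conv-geometric q f g zero    = begin
    conv (λ i → q ^ i * f i) (λ j → q ^ j * g j) 0    ≈⟨ conv-zero _ _ ⟩
    1# * f 0 * (1# * g 0)                             ≈⟨ solve 2 (λ x y → 𝟏 :* x :* (𝟏 :* y) := 𝟏 :* (x :* y)) refl (f 0) (g 0) ⟩
    1# * (f 0 * g 0)                                  ≈⟨ *-congˡ (conv-zero f g) ⟨
    1# * conv f g 0                                   ∎
  conv-geometric q f g (suc k) = begin
    conv (λ i → q ^ i * f i) (λ j → q ^ j * g j) (suc k)
      ≈⟨ conv-suc _ _ k ⟩
    1# * f 0 * (q * q ^ k * g (suc k)) + conv (λ i → q * q ^ i * f (suc i)) (λ j → q ^ j * g j) k
      ≈⟨ +-congˡ (trans (conv-cong k (λ i → *-assoc _ _ _) (λ _ → refl)) (conv-*ˡ q _ _ k)) ⟩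
    1# * f 0 * (q * q ^ k * g (suc k)) + q * conv (λ i → q ^ i * f (suc i)) (λ j → q ^ j * g j) k
      ≈⟨ +-congˡ (*-congˡ (conv-geometric q (f ∘ suc) g k)) ⟩
    1# * f 0 * (q * q ^ k * g (suc k)) + q * (q ^ k * conv (f ∘ suc) g k)
      ≈⟨ solve 5 (λ x y q qᵏ z → 𝟏 :* x :* (q :* qᵏ :* y) :+ q :* (qᵏ :* z)
                              := q :* qᵏ :* (x :* y :+ z)) refl _ _ _ _ _ ⟩
    q * q ^ k * (f 0 * g (suc k) + conv (f ∘ suc) g k)
      ≈⟨ *-congˡ (conv-suc f g k) ⟨
    q ^ suc k * conv f g (suc k)
      ∎

  -- Applied with u and u v two consecutive Pochhammer symbols, so that v is the last factor and w
  -- the inverse of the longer one.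
  cancel-units : ∀ {u u⁻¹ v w} → u⁻¹ * u ≈ 1# → u * v * w ≈ 1# → v * w ≈ u⁻¹
  cancel-units {u} {u⁻¹} {v} {w} u⁻¹u≈1 uvw≈1 = begin
    v * w                ≈⟨ *-identityˡ _ ⟨
    1# * (v * w)         ≈⟨ *-congʳ u⁻¹u≈1 ⟨
    u⁻¹ * u * (v * w)    ≈⟨ solve 4 (λ u u⁻¹ v w → u⁻¹ :* u :* (v :* w) := u⁻¹ :* (u :* v :* w)) refl u u⁻¹ v w ⟩
    u⁻¹ * (u * v * w)    ≈⟨ *-congˡ uvw≈1 ⟩
    u⁻¹ * 1#             ≈⟨ *-identityʳ _ ⟩
    u⁻¹                  ∎

  module _ {α β q : Carrier} (generic : Generic α β q) where
    open Generic generic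

    s p : Carrier
    s = α + β
    p = α * β

    r : ℕ → Carrier
    r = 1/⟨q⨾q⟩

    P : ℕ → Carrier
    P = ⟨ p ⨾ q ⟩

    r-suc : ∀ n → (1# - q * q ^ n) * r (suc n) ≈ r n
    r-suc n = cancel-units (proj₁ (proj₂ (q-invertible n))) (proj₂ (proj₂ (q-invertible (suc n))))

    1/P-suc : ∀ n → (1# - p * q ^ n) * 1/⟨αβ⨾q⟩ (suc n) ≈ 1/⟨αβ⨾q⟩ n
    1/P-suc n = cancel-units (proj₁ (proj₂ (αβ-invertible n))) (proj₂ (proj₂ (αβ-invertible (suc n))))

    r-zero : r 0 ≈ 1#
    r-zero = trans (sym (*-identityˡ _)) (proj₂ (proj₂ (q-invertible 0)))

    -- The coefficients of (-zt;q)_∞.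
    a : Carrier → ℕ → Carrier
    a z i = z ^ i * q ^ (i C 2) * r i

    a-zero : ∀ z → a z 0 ≈ 1#
    a-zero z = trans (*-congˡ r-zero) (solve 0 (𝟏 :* 𝟏 :* 𝟏 := 𝟏) refl)

    -- The functional equation (-zt;q)_∞ = (1 + zt) (-zqt;q)_∞, read off at t^(i+1).
    a-suc : ∀ z i → (1# - q * q ^ i) * a z (suc i) ≈ z * (q ^ i * a z i)
    a-suc z i = begin
      (1# - q * q ^ i) * (z * z ^ i * q ^ (suc i C 2) * r (suc i))
        ≈⟨ *-congˡ (*-congʳ (*-congˡ (trans (^-congʳ q binomial) (^-homo-* q i (i C 2))))) ⟩
      (1# - q * q ^ i) * (z * z ^ i * (q ^ i * q ^ (i C 2)) * r (suc i))
        ≈⟨ solve 6 (λ c z zⁱ qⁱ w ρ → c :* (z :* zⁱ :* (qⁱ :* w) :* ρ) := z :* (qⁱ :* (zⁱ :* w :* (c :* ρ)))) refl _ _ _ _ _ _ ⟩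
      z * (q ^ i * (z ^ i * q ^ (i C 2) * ((1# - q * q ^ i) * r (suc i))))
        ≈⟨ *-congˡ (*-congˡ (*-congˡ (r-suc i))) ⟩
      z * (q ^ i * a z i)
        ∎
      where
      binomial : suc i C 2 ≡ i ℕ.+ i C 2
      binomial = ≡.trans (≡.sym (nCk+nC[k+1]≡[n+1]C[k+1] i 1)) (≡.cong (ℕ._+ i C 2) (nC1≡n i))

    -- Writes A(t) as (A(t) - A(qt)) + A(qt); the difference has no constant term, and `a-suc`
    -- evaluates its other coefficients.
    a-defect : ∀ z i → a z i ≈ (1# - q ^ i) * a z i + q ^ i * a z i
    a-defect z i = solve 2 (λ x y → y := (𝟏 :- x) :* y :+ x :* y) refl _ _

    vanishes-at-zero : ∀ x → (1# - 1#) * x ≈ 0#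
    vanishes-at-zero = solve 1 (λ x → (𝟏 :- 𝟏) :* x := 𝟎) refl

    -- The sequence h and its three-term recurrence.

    h : ℕ → Carrier
    h = conv (a α) (a β)

    h-zero : h 0 ≈ 1#
    h-zero = trans (conv-zero _ _) (trans (*-cong (a-zero α) (a-zero β)) (*-identityˡ _))

    η : ℕ → ℕ → Carrier
    η = shift h

    -- The coefficients of (-αqt;q)_∞ (-βt;q)_∞.
    g : ℕ → Carrier
    g = conv (λ i → q ^ i * a α i) (a β)

    -- With H and G the generating functions of `h` and `g`, this is H(t) = (1 + αt) G(t).
    h-suc : ∀ k → h (suc k) ≈ α * g k + g (suc k)
    h-suc k = begin
      h (suc k)
        ≈⟨ conv-cong (suc k) (a-defect α) (λ _ → refl) ⟩
      conv (λ i → (1# - q ^ i) * a α i + q ^ i * a α i) (a β) (suc k)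
        ≈⟨ conv-+ˡ _ _ _ (suc k) ⟩
      conv (λ i → (1# - q ^ i) * a α i) (a β) (suc k) + g (suc k)
        ≈⟨ +-congʳ (conv-tailˡ (λ i → (1# - q ^ i) * a α i) (a β) k (vanishes-at-zero _)) ⟩
      conv (λ i → (1# - q * q ^ i) * a α (suc i)) (a β) k + g (suc k)
        ≈⟨ +-congʳ (trans (conv-cong k (a-suc α) (λ _ → refl)) (conv-*ˡ α _ _ k)) ⟩
      α * g k + g (suc k)
        ∎

    -- This is G(t) = (1 + βt) H(qt). At k = 0 the truncated exponent does no harm, because `η 0 1`
    -- is zero.
    g-expand : ∀ k → g k ≈ q ^ k * h k + β * q ^ (k ∸ 1) * η k 1
    g-expand zero    = begin
      g 0                           ≈⟨ conv-zero _ _ ⟩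
      1# * a α 0 * a β 0            ≈⟨ solve 3 (λ x y z → 𝟏 :* x :* y := 𝟏 :* (x :* y) :+ z :* 𝟎) refl _ _ (β * 1#) ⟩
      1# * (a α 0 * a β 0) + β * 1# * 0#    ≈⟨ +-congʳ (*-congˡ (conv-zero _ _)) ⟨
      1# * h 0 + β * 1# * 0#        ∎
    g-expand (suc k) = begin
      g (suc k)
        ≈⟨ conv-cong (suc k) (λ _ → refl) (λ j → trans (a-defect β j) (+-comm _ _)) ⟩
      conv (λ i → q ^ i * a α i) (λ j → q ^ j * a β j + (1# - q ^ j) * a β j) (suc k)
        ≈⟨ conv-+ʳ _ _ _ (suc k) ⟩
      conv (λ i → q ^ i * a α i) (λ j → q ^ j * a β j) (suc k)
        + conv (λ i → q ^ i * a α i) (λ j → (1# - q ^ j) * a β j) (suc k)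
        ≈⟨ +-cong (conv-geometric q (a α) (a β) (suc k))
                  (conv-tailʳ (λ i → q ^ i * a α i) (λ j → (1# - q ^ j) * a β j) k (vanishes-at-zero _)) ⟩
      q ^ suc k * h (suc k) + conv (λ i → q ^ i * a α i) (λ j → (1# - q * q ^ j) * a β (suc j)) k
        ≈⟨ +-congˡ (trans (conv-cong k (λ _ → refl) (a-suc β)) (conv-*ʳ β _ _ k)) ⟩
      q ^ suc k * h (suc k) + β * conv (λ i → q ^ i * a α i) (λ j → q ^ j * a β j) k
        ≈⟨ +-congˡ (trans (*-congˡ (conv-geometric q (a α) (a β) k)) (sym (*-assoc _ _ _))) ⟩
      q ^ suc k * h (suc k) + β * q ^ k * h k
        ∎

    -- Eliminating `g` from `h-suc` and `g-expand` gives the recurrence of h at index N - L. It is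
    -- stated for all N and L so that it can be used without a case distinction.
    η-step : ∀ N L → (1# - q ^ (suc N ∸ L)) * η (suc N) L
                   ≈ s * q ^ (N ∸ L) * η N L + p * q ^ (N ∸ suc L) * η N (suc L)
    η-step N zero = begin
      (1# - q * q ^ N) * h (suc N)
        ≈⟨ solve 2 (λ x y → (𝟏 :- x) :* y := y :- x :* y) refl _ _ ⟩
      h (suc N) - q * q ^ N * h (suc N)
        ≈⟨ +-congʳ (trans (h-suc N) (+-cong (*-congˡ (g-expand N)) (g-expand (suc N)))) ⟩
      α * (q ^ N * h N + β * q ^ (N ∸ 1) * η N 1) + (q * q ^ N * h (suc N) + β * q ^ N * h N)
        - q * q ^ N * h (suc N)
        ≈⟨ solve 7 (λ α β x y z u v →
             α :* (x :* y :+ β :* z :* u) :+ (v :+ β :* x :* y) :- v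
             := (α :+ β) :* x :* y :+ α :* β :* z :* u) refl
             α β (q ^ N) (h N) (q ^ (N ∸ 1)) (η N 1) (q * q ^ N * h (suc N)) ⟩
      s * q ^ N * h N + p * q ^ (N ∸ 1) * η N 1
        ∎
    -- Here N + 1 = L: the right side is zero, and on the left h 0 is killed by 1 - q^0.
    η-step zero    (suc zero)    =
      solve 3 (λ x y z → (𝟏 :- 𝟏) :* x := y :* 𝟎 :+ z :* 𝟎) refl (h 0) (s * 1#) (p * 1#)
    η-step zero    (suc (suc L)) =
      solve 2 (λ y z → (𝟏 :- 𝟏) :* 𝟎 := y :* 𝟎 :+ z :* 𝟎) refl (s * 1#) (p * 1#)
    η-step (suc N) (suc L) = η-step N L

    -- The summands of S and their supports.

    ρ : ℕ → ℕ → Carrier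
    ρ = shift r

    -- The recursion of 1/(q;q)_k extended to all integers k = m - n: at k = 0 the factor 1 - q^0
    -- vanishes, and below that both sides are zero.
    ρ-step : ∀ m n → (1# - q ^ (m ∸ n)) * ρ m n ≈ ρ m (suc n)
    ρ-step zero    zero    = vanishes-at-zero _
    ρ-step (suc m) zero    = r-suc m
    ρ-step zero    (suc n) = zeroʳ _
    ρ-step (suc m) (suc n) = ρ-step m n

    ρ³ : (M n₁ n₂ n₃ : ℕ) → Carrier
    ρ³ M n₁ n₂ n₃ = ρ M n₁ * ρ M n₂ * ρ M n₃

    summand : (n₁ n₂ n₃ M : ℕ) → Carrier
    summand n₁ n₂ n₃ M = P M * ρ³ M n₁ n₂ n₃ * η (n₁ ℕ.+ n₂ ℕ.+ n₃) (M ℕ.* 2)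

    -- The summand at n₁ - 1, which still makes sense (and vanishes) for n₁ = 0.
    summand⁻ : (n₁ n₂ n₃ M : ℕ) → Carrier
    summand⁻ n₁ n₂ n₃ M =
      P M * (ρ (suc M) n₁ * ρ M n₂ * ρ M n₃) * η (n₁ ℕ.+ n₂ ℕ.+ n₃) (suc (M ℕ.* 2))

    -- `on-support` for all four factors at once. The index m is kept apart from M because
    -- `summand⁻` contains `ρ (suc M) n₁`.
    support : ∀ m n₁ M n₂ n₃ N L {x y} →
      (n₁ ≤ m → n₂ ≤ M → n₃ ≤ M → L ≤ N → x ≈ y) →
      x * (ρ m n₁ * ρ M n₂ * ρ M n₃ * η N L) ≈ y * (ρ m n₁ * ρ M n₂ * ρ M n₃ * η N L)
    support m n₁ M n₂ n₃ N L {x} {y} x≈y = begin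
      x * (ρ m n₁ * ρ M n₂ * ρ M n₃ * η N L)
        ≈⟨ reassociate _ _ _ _ _ ⟩
      x * ρ m n₁ * ρ M n₂ * ρ M n₃ * η N L
        ≈⟨ on-support h N L (λ l → on-support r M n₃ (λ k → on-support r M n₂ (λ j →
             on-support r m n₁ (λ i → x≈y i j k l)))) ⟩
      y * ρ m n₁ * ρ M n₂ * ρ M n₃ * η N L
        ≈⟨ reassociate _ _ _ _ _ ⟨
      y * (ρ m n₁ * ρ M n₂ * ρ M n₃ * η N L)
        ∎
      where
      reassociate = solve 5 (λ x a b c d → x :* (a :* b :* c :* d) := x :* a :* b :* c :* d) refl

    -- In (M - n₂) + (M - n₃) + (n₁ + n₂ + n₃ - j - 2M) everything cancels except n₁ - j. The case j
    -- = 1 serves the lowered index, and also shows there that n₁ is positive.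
    balance : ∀ {M n₁ n₂ n₃ k} j → n₂ ≤ M → n₃ ≤ M → k ℕ.+ (j ℕ.+ M ℕ.* 2) ≡ n₁ ℕ.+ n₂ ℕ.+ n₃ →
      j ℕ.+ (M ∸ n₂ ℕ.+ (M ∸ n₃) ℕ.+ k) ≡ n₁
    balance {M} {n₁} {n₂} {n₃} {k} j n₂≤M n₃≤M eq =
      ℕ.+-cancelʳ-≡ (n₂ ℕ.+ n₃) _ _ (≡.trans total (≡.trans eq (ℕ.+-assoc n₁ n₂ n₃)))
      where
      regroup : ∀ j b c k n₂ n₃ →
        j ℕ.+ (b ℕ.+ c ℕ.+ k) ℕ.+ (n₂ ℕ.+ n₃) ≡ k ℕ.+ (j ℕ.+ ((b ℕ.+ n₂) ℕ.+ (c ℕ.+ n₃)))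
      regroup = solveℕ 6 (λ j b c k n₂ n₃ →
        j ⊕ (b ⊕ c ⊕ k) ⊕ (n₂ ⊕ n₃) ⊜ k ⊕ (j ⊕ ((b ⊕ n₂) ⊕ (c ⊕ n₃)))) ≡.refl
      total : j ℕ.+ (M ∸ n₂ ℕ.+ (M ∸ n₃) ℕ.+ k) ℕ.+ (n₂ ℕ.+ n₃) ≡ k ℕ.+ (j ℕ.+ M ℕ.* 2)
      total = ≡.trans (regroup j (M ∸ n₂) (M ∸ n₃) k n₂ n₃)
        (≡.cong (λ m → k ℕ.+ (j ℕ.+ m))
          (≡.trans (≡.cong₂ ℕ._+_ (ℕ.m∸n+n≡m n₂≤M) (ℕ.m∸n+n≡m n₃≤M)) (m+m≡m*2 M)))

    ^-+³ : ∀ a b c {d} → a ℕ.+ b ℕ.+ c ≡ d → q ^ a * q ^ b * q ^ c ≈ q ^ d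
    ^-+³ a b c ≡.refl = sym (trans (^-homo-* q (a ℕ.+ b) c) (*-congʳ (^-homo-* q a b)))

    -- The three-term operator in n₁ applied to a single summand.

    module Termwise (n₁ n₂ n₃ : ℕ) where

      N : ℕ
      N = n₁ ℕ.+ n₂ ℕ.+ n₃

      A : ℕ → ℕ → Carrier
      A M n = q ^ (M ∸ n)

      -- What the operator leaves once the telescoping part is summed away. The three indices enter
      -- symmetrically, which is what allows n₁ and n₃ to be exchanged.
      symmetric : ℕ → Carrier
      symmetric M = P M * ρ³ M n₁ n₂ n₃
        * (1# + 1# - (A M n₁ + A M n₂ + A M n₃) + q * q ^ M) * η (suc N) (M ℕ.* 2)

      -- The telescoping part: lowering n₁ shifts M by one.
      edge : ℕ → Carrier
      edge M = P M * ρ³ M n₁ n₂ n₃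
        * ((1# - A M n₂) * (1# - A M n₃)) * η (suc N) (M ℕ.* 2)

      module _ (M : ℕ) where

        L : ℕ
        L = M ℕ.* 2

        t t⁻ u A₁ A₂ A₃ K K⁺ K⁻ B₁ B₂ B₃ ρ₁ ρ₂ ρ₃ ρ₁′ ρ₂′ ρ₃′ η₀ η⁺ η⁻ : Carrier
        t = q ^ n₁
        t⁻ = q ^ (n₁ ∸ 1)
        u = P M
        A₁ = A M n₁
        A₂ = A M n₂
        A₃ = A M n₃
        K = q ^ (N ∸ L)
        K⁺ = q ^ (suc N ∸ L)
        K⁻ = q ^ (N ∸ suc L)
        B₁ = A (suc M) n₁
        B₂ = A (suc M) n₂
        B₃ = A (suc M) n₃
        ρ₁ = ρ M n₁
        ρ₂ = ρ M n₂
        ρ₃ = ρ M n₃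
        ρ₁′ = ρ (suc M) n₁
        ρ₂′ = ρ (suc M) n₂
        ρ₃′ = ρ (suc M) n₃
        η₀ = η N L
        η⁺ = η (suc N) L
        η⁻ = η N (suc L)

        -- This and the next four lemmas trade the powers of q in the operator for powers attached
        -- to the factors of the summand, the form in which `ρ-step` and `η-step` apply. The
        -- exponents agree only on the support.
        weight₀ : A₂ * A₃ * K * (ρ₁ * ρ₂ * ρ₃ * η₀) ≈ t * (ρ₁ * ρ₂ * ρ₃ * η₀)
        weight₀ = support M n₁ M n₂ n₃ N L λ _ n₂≤M n₃≤M L≤N →
          ^-+³ (M ∸ n₂) (M ∸ n₃) (N ∸ L) (balance 0 n₂≤M n₃≤M (ℕ.m∸n+n≡m L≤N))

        weight⁻ : A₂ * A₃ * K⁻ * (ρ₁ * ρ₂ * ρ₃ * η⁻) ≈ t⁻ * (ρ₁ * ρ₂ * ρ₃ * η⁻)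
        weight⁻ = support M n₁ M n₂ n₃ N (suc L) λ _ n₂≤M n₃≤M L<N →
          ^-+³ (M ∸ n₂) (M ∸ n₃) (N ∸ suc L)
            (≡.cong ℕ.pred (balance 1 n₂≤M n₃≤M (ℕ.m∸n+n≡m L<N)))

        weight⁺ : A₂ * A₃ * K⁺ * (ρ₁ * ρ₂ * ρ₃ * η⁺) ≈ q * t * (ρ₁ * ρ₂ * ρ₃ * η⁺)
        weight⁺ = support M n₁ M n₂ n₃ (suc N) L λ _ n₂≤M n₃≤M L≤N →
          ^-+³ (M ∸ n₂) (M ∸ n₃) (suc N ∸ L)
            (balance {n₁ = suc n₁} 0 n₂≤M n₃≤M (ℕ.m∸n+n≡m L≤N))

        weight-M : A₁ * t * (ρ₁ * ρ₂ * ρ₃ * η⁺) ≈ q ^ M * (ρ₁ * ρ₂ * ρ₃ * η⁺)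
        weight-M = support M n₁ M n₂ n₃ (suc N) L λ n₁≤M _ _ _ →
          trans (sym (^-homo-* q (M ∸ n₁) n₁)) (^-congʳ q (ℕ.m∸n+n≡m n₁≤M))

        weight-M⁻ : t⁻ * B₁ * (ρ₁′ * ρ₂ * ρ₃ * η⁻) ≈ q ^ M * (ρ₁′ * ρ₂ * ρ₃ * η⁻)
        weight-M⁻ = support (suc M) n₁ M n₂ n₃ N (suc L) λ n₁≤1+M n₂≤M n₃≤M L<N →
          trans (sym (^-homo-* q (n₁ ∸ 1) (suc M ∸ n₁)))
            (^-congʳ q (exponent n₁≤1+M (balance {n₁ = n₁} 1 n₂≤M n₃≤M (ℕ.m∸n+n≡m L<N))))
          where
          -- The equation for n excludes n = 0, where truncation would make the sum `suc M`.
          exponent : ∀ {n k} → n ≤ suc M → suc k ≡ n → n ∸ 1 ℕ.+ (suc M ∸ n) ≡ M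
          exponent (s≤s n≤M) _ = ℕ.m+[n∸m]≡n n≤M

        -- The first term is the remainder produced by `middle`. Since ρ₁ = (1 - B₁) ρ₁′ and t⁻ B₁ =
        -- q^M on the support, the two terms combine to the factor 1 - p q^M, which promotes (p;q)_M
        -- to (p;q)_{M+1}. Raising ρ₂ and ρ₃ as well costs (1 - B₂)(1 - B₃).
        lowering : p * t⁻ * (u * (ρ₁ * ρ₂ * ρ₃ * η⁻)) + (1# - p * t⁻) * summand⁻ n₁ n₂ n₃ M ≈ edge (suc M)
        lowering = begin
          p * t⁻ * (u * (ρ₁ * ρ₂ * ρ₃ * η⁻)) + (1# - p * t⁻) * (u * (ρ₁′ * ρ₂ * ρ₃) * η⁻)
            ≈⟨ +-congʳ (*-congˡ (*-congˡ (*-congʳ (*-congʳ (*-congʳ (sym (ρ-step (suc M) n₁))))))) ⟩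
          p * t⁻ * (u * ((1# - B₁) * ρ₁′ * ρ₂ * ρ₃ * η⁻)) + (1# - p * t⁻) * (u * (ρ₁′ * ρ₂ * ρ₃) * η⁻)
            ≈⟨ solve 8 (λ p t⁻ u B₁ ρ₁′ ρ₂ ρ₃ η⁻ →
                 p :* t⁻ :* (u :* ((𝟏 :- B₁) :* ρ₁′ :* ρ₂ :* ρ₃ :* η⁻))
                   :+ (𝟏 :- p :* t⁻) :* (u :* (ρ₁′ :* ρ₂ :* ρ₃) :* η⁻)
                 := u :* (ρ₁′ :* ρ₂ :* ρ₃ :* η⁻) :- p :* u :* (t⁻ :* B₁ :* (ρ₁′ :* ρ₂ :* ρ₃ :* η⁻)))
                 refl p t⁻ u B₁ ρ₁′ ρ₂ ρ₃ η⁻ ⟩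
          u * (ρ₁′ * ρ₂ * ρ₃ * η⁻) - p * u * (t⁻ * B₁ * (ρ₁′ * ρ₂ * ρ₃ * η⁻))
            ≈⟨ +-congˡ (-‿cong (*-congˡ weight-M⁻)) ⟩
          u * (ρ₁′ * ρ₂ * ρ₃ * η⁻) - p * u * (q ^ M * (ρ₁′ * ρ₂ * ρ₃ * η⁻))
            ≈⟨ solve 7 (λ p m u ρ₁′ ρ₂ ρ₃ η⁻ →
                 u :* (ρ₁′ :* ρ₂ :* ρ₃ :* η⁻) :- p :* u :* (m :* (ρ₁′ :* ρ₂ :* ρ₃ :* η⁻))
                 := u :* (𝟏 :- p :* m) :* (ρ₁′ :* ρ₂ :* ρ₃) :* η⁻)
                 refl p (q ^ M) u ρ₁′ ρ₂ ρ₃ η⁻ ⟩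
          u * (1# - p * q ^ M) * (ρ₁′ * ρ₂ * ρ₃) * η⁻
            ≈⟨ *-congʳ (*-congˡ (*-cong (*-congˡ (sym (ρ-step (suc M) n₂))) (sym (ρ-step (suc M) n₃)))) ⟩
          u * (1# - p * q ^ M) * (ρ₁′ * ((1# - B₂) * ρ₂′) * ((1# - B₃) * ρ₃′)) * η⁻
            ≈⟨ solve 7 (λ v ρ₁′ b₂ ρ₂′ b₃ ρ₃′ η⁻ →
                 v :* (ρ₁′ :* (b₂ :* ρ₂′) :* (b₃ :* ρ₃′)) :* η⁻
                 := v :* (ρ₁′ :* ρ₂′ :* ρ₃′) :* (b₂ :* b₃) :* η⁻)
                 refl (u * (1# - p * q ^ M)) ρ₁′ (1# - B₂) ρ₂′ (1# - B₃) ρ₃′ η⁻ ⟩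
          -- Holds by computation: `P` and `η` unfold by one step, and `η (suc N) (suc M ℕ.* 2)`
          -- reduces to η⁻.
          edge (suc M)
            ∎

        -- Once t is replaced by A₂ A₃ K, the term s K η₀ is half of the right side of `η-step`.
        -- Solving for it introduces η⁺, the factor also present in the raised summand, at the price
        -- of a remainder with η⁻.
        middle : s * t * summand n₁ n₂ n₃ M
               ≈ u * (ρ₁ * ρ₂ * ρ₃) * (A₂ * A₃ * (1# - K⁺)) * η⁺ - p * t⁻ * (u * (ρ₁ * ρ₂ * ρ₃ * η⁻))
        middle = begin
          s * t * (u * (ρ₁ * ρ₂ * ρ₃) * η₀)
            ≈⟨ solve 5 (λ s t u w η₀ → s :* t :* (u :* w :* η₀) := s :* u :* (t :* (w :* η₀)))
                 refl s t u (ρ₁ * ρ₂ * ρ₃) η₀ ⟩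
          s * u * (t * (ρ₁ * ρ₂ * ρ₃ * η₀))
            ≈⟨ *-congˡ weight₀ ⟨
          s * u * (A₂ * A₃ * K * (ρ₁ * ρ₂ * ρ₃ * η₀))
            ≈⟨ solve 9 (λ s u A K w η₀ p K⁻ η⁻ →
                 s :* u :* (A :* K :* (w :* η₀))
                 := u :* w :* A :* (s :* K :* η₀ :+ p :* K⁻ :* η⁻) :- p :* u :* (A :* K⁻ :* (w :* η⁻)))
                 refl s u (A₂ * A₃) K (ρ₁ * ρ₂ * ρ₃) η₀ p K⁻ η⁻ ⟩
          u * (ρ₁ * ρ₂ * ρ₃) * (A₂ * A₃) * (s * K * η₀ + p * K⁻ * η⁻)
            - p * u * (A₂ * A₃ * K⁻ * (ρ₁ * ρ₂ * ρ₃ * η⁻))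
            ≈⟨ +-cong (*-congˡ (sym (η-step N L))) (-‿cong (*-congˡ weight⁻)) ⟩
          u * (ρ₁ * ρ₂ * ρ₃) * (A₂ * A₃) * ((1# - K⁺) * η⁺) - p * u * (t⁻ * (ρ₁ * ρ₂ * ρ₃ * η⁻))
            ≈⟨ solve 8 (λ u w A k η⁺ p t⁻ η⁻ →
                 u :* w :* A :* (k :* η⁺) :- p :* u :* (t⁻ :* (w :* η⁻))
                 := u :* w :* (A :* k) :* η⁺ :- p :* t⁻ :* (u :* (w :* η⁻)))
                 refl u (ρ₁ * ρ₂ * ρ₃) (A₂ * A₃) (1# - K⁺) η⁺ p t⁻ η⁻ ⟩
          u * (ρ₁ * ρ₂ * ρ₃) * (A₂ * A₃ * (1# - K⁺)) * η⁺ - p * t⁻ * (u * (ρ₁ * ρ₂ * ρ₃ * η⁻))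
            ∎

        main : Carrier
        main = u * (ρ₁ * ρ₂ * ρ₃) * ((1# - A₁) * (1# - q * t) - A₂ * A₃ * (1# - K⁺)) * η⁺

        -- The asymmetry cancels: A₂ A₃ between `main` and `edge`, then q t against A₂ A₃ K⁺, while
        -- q A₁ t becomes q q^M.
        main+edge : main + edge M ≈ symmetric M
        main+edge = begin
          main + edge M
            ≈⟨ solve 9 (λ u w A₁ A₂ A₃ q t η⁺ K⁺ →
                 u :* w :* ((𝟏 :- A₁) :* (𝟏 :- q :* t) :- A₂ :* A₃ :* (𝟏 :- K⁺)) :* η⁺
                   :+ u :* w :* ((𝟏 :- A₂) :* (𝟏 :- A₃)) :* η⁺
                 := u :* ((𝟏 :- A₁ :- q :* t :+ 𝟏 :- A₂ :- A₃) :* (w :* η⁺)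
                          :+ q :* (A₁ :* t :* (w :* η⁺)) :+ A₂ :* A₃ :* K⁺ :* (w :* η⁺)))
                 refl u (ρ₁ * ρ₂ * ρ₃) A₁ A₂ A₃ q t η⁺ K⁺ ⟩
          u * ((1# - A₁ - q * t + 1# - A₂ - A₃) * (ρ₁ * ρ₂ * ρ₃ * η⁺)
               + q * (A₁ * t * (ρ₁ * ρ₂ * ρ₃ * η⁺)) + A₂ * A₃ * K⁺ * (ρ₁ * ρ₂ * ρ₃ * η⁺))
            ≈⟨ *-congˡ (+-cong (+-congˡ (*-congˡ weight-M)) weight⁺) ⟩
          u * ((1# - A₁ - q * t + 1# - A₂ - A₃) * (ρ₁ * ρ₂ * ρ₃ * η⁺)
               + q * (q ^ M * (ρ₁ * ρ₂ * ρ₃ * η⁺)) + q * t * (ρ₁ * ρ₂ * ρ₃ * η⁺))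
            ≈⟨ solve 9 (λ u w A₁ A₂ A₃ q t η⁺ m →
                 u :* ((𝟏 :- A₁ :- q :* t :+ 𝟏 :- A₂ :- A₃) :* (w :* η⁺)
                       :+ q :* (m :* (w :* η⁺)) :+ q :* t :* (w :* η⁺))
                 := u :* w :* (𝟏 :+ 𝟏 :- (A₁ :+ A₂ :+ A₃) :+ q :* m) :* η⁺)
                 refl u (ρ₁ * ρ₂ * ρ₃) A₁ A₂ A₃ q t η⁺ (q ^ M) ⟩
          symmetric M
            ∎

        recurrence-term :
          (1# - q * t) * summand (suc n₁) n₂ n₃ M
            + (- (s * t) * summand n₁ n₂ n₃ M + (1# - p * t⁻) * summand⁻ n₁ n₂ n₃ M)
          ≈ main + edge (suc M)
        recurrence-term = begin
          (1# - q * t) * (u * (ρ M (suc n₁) * ρ₂ * ρ₃) * η⁺)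
            + (- (s * t) * summand n₁ n₂ n₃ M + (1# - p * t⁻) * summand⁻ n₁ n₂ n₃ M)
            ≈⟨ +-cong (*-congˡ (*-congʳ (*-congˡ (*-congʳ (*-congʳ (sym (ρ-step M n₁)))))))
                 (+-congʳ (trans (solve 2 (λ x y → (:- x) :* y := :- (x :* y)) refl _ _) (-‿cong middle))) ⟩
          (1# - q * t) * (u * ((1# - A₁) * ρ₁ * ρ₂ * ρ₃) * η⁺)
            + (- (u * (ρ₁ * ρ₂ * ρ₃) * (A₂ * A₃ * (1# - K⁺)) * η⁺ - p * t⁻ * (u * (ρ₁ * ρ₂ * ρ₃ * η⁻)))
               + (1# - p * t⁻) * summand⁻ n₁ n₂ n₃ M)
            ≈⟨ solve 10 (λ T u A₁ ρ₁ ρ₂ ρ₃ B η⁺ d₁ d₂ →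
                 T :* (u :* (A₁ :* ρ₁ :* ρ₂ :* ρ₃) :* η⁺) :+ (:- (u :* (ρ₁ :* ρ₂ :* ρ₃) :* B :* η⁺ :- d₁) :+ d₂)
                 := u :* (ρ₁ :* ρ₂ :* ρ₃) :* (A₁ :* T :- B) :* η⁺ :+ (d₁ :+ d₂))
                 refl (1# - q * t) u (1# - A₁) ρ₁ ρ₂ ρ₃ (A₂ * A₃ * (1# - K⁺)) η⁺
                   (p * t⁻ * (u * (ρ₁ * ρ₂ * ρ₃ * η⁻))) ((1# - p * t⁻) * summand⁻ n₁ n₂ n₃ M) ⟩
          main + (p * t⁻ * (u * (ρ₁ * ρ₂ * ρ₃ * η⁻)) + (1# - p * t⁻) * summand⁻ n₁ n₂ n₃ M)
            ≈⟨ +-congˡ lowering ⟩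
          main + edge (suc M)
            ∎

      -- Truncation makes `0 ∸ n₂` zero for every n₂, so one factor is 1 - q^0.
      edge-first : edge 0 ≈ 0#
      edge-first = begin
        P 0 * ρ³ 0 n₁ n₂ n₃ * ((1# - q ^ (0 ∸ n₂)) * (1# - A 0 n₃)) * η (suc N) 0
          ≈⟨ *-congʳ (*-congˡ (*-congʳ (+-congˡ (-‿cong (^-congʳ q (ℕ.0∸n≡0 n₂)))))) ⟩
        P 0 * ρ³ 0 n₁ n₂ n₃ * ((1# - 1#) * (1# - A 0 n₃)) * η (suc N) 0
          ≈⟨ solve 3 (λ x y z → x :* ((𝟏 :- 𝟏) :* y) :* z := 𝟎) refl _ _ _ ⟩
        0#
          ∎

      edge-last : ∀ {M} → suc N < M ℕ.* 2 → edge M ≈ 0#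
      edge-last 1+N<2M = trans (*-congˡ (reflexive (shift-< h 1+N<2M))) (zeroʳ _)

    summand-vanishes : ∀ n₁ n₂ n₃ {M} → (n₁ ≤ M → n₂ ≤ M → n₃ ≤ M → M ℕ.* 2 ≤ n₁ ℕ.+ n₂ ℕ.+ n₃ → P M ≈ 0#) →
      summand n₁ n₂ n₃ M ≈ 0#
    summand-vanishes n₁ n₂ n₃ {M} P≈0 = begin
      P M * ρ³ M n₁ n₂ n₃ * η N (M ℕ.* 2)     ≈⟨ *-assoc _ _ _ ⟩
      P M * (ρ³ M n₁ n₂ n₃ * η N (M ℕ.* 2))   ≈⟨ support M n₁ M n₂ n₃ N (M ℕ.* 2) P≈0 ⟩
      0# * (ρ³ M n₁ n₂ n₃ * η N (M ℕ.* 2))    ≈⟨ zeroˡ _ ⟩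
      0#                                      ∎
      where N = n₁ ℕ.+ n₂ ℕ.+ n₃

    -- The symmetric sums S.

    S : (n₁ n₂ n₃ : ℕ) → Carrier
    S n₁ n₂ n₃ = Σ< (suc (n₁ ℕ.+ n₂ ℕ.+ n₃)) (summand n₁ n₂ n₃)

    S-extend : ∀ n₁ n₂ n₃ {B} → n₁ ℕ.+ n₂ ℕ.+ n₃ < B → Σ< B (summand n₁ n₂ n₃) ≈ S n₁ n₂ n₃
    S-extend n₁ n₂ n₃ N<B = Σ-truncate _ N<B λ M N<M → summand-vanishes n₁ n₂ n₃ λ _ _ _ 2M≤N →
      contradiction (ℕ.≤-trans (ℕ.m≤m*n M 2) 2M≤N) (ℕ.<⇒≱ N<M)

    -- A nonzero term needs n₃ ≤ M and 2M ≤ n₁ + n₂ + n₃, hence n₃ ≤ n₁ + n₂. This makes the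
    -- expansion finite.
    S-vanishes : ∀ n₁ n₂ n₃ → n₁ ℕ.+ n₂ < n₃ → S n₁ n₂ n₃ ≈ 0#
    S-vanishes n₁ n₂ n₃ n₁+n₂<n₃ = Σ-zero _ λ M → summand-vanishes n₁ n₂ n₃ λ _ _ n₃≤M 2M≤N →
      contradiction
        (ℕ.+-cancelʳ-≤ n₃ n₃ (n₁ ℕ.+ n₂)
          (ℕ.≤-trans (ℕ.+-mono-≤ n₃≤M (ℕ.≤-trans n₃≤M (ℕ.≤-reflexive (≡.sym (ℕ.+-identityʳ M)))))
            (ℕ.≤-trans (ℕ.≤-reflexive (ℕ.*-comm 2 M)) 2M≤N)))
        (ℕ.<⇒≱ n₁+n₂<n₃)

    S-swap : ∀ n₁ n₂ n₃ → S n₁ n₂ n₃ ≈ S n₃ n₂ n₁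
    S-swap n₁ n₂ n₃ = begin
      S n₁ n₂ n₃                       ≈⟨ Σ-cong _ swap ⟩
      Σ< (suc N) (summand n₃ n₂ n₁)    ≡⟨ ≡.cong (λ k → Σ< (suc k) (summand n₃ n₂ n₁)) N≡N′ ⟩
      S n₃ n₂ n₁                       ∎
      where
      N N′ : ℕ
      N  = n₁ ℕ.+ n₂ ℕ.+ n₃
      N′ = n₃ ℕ.+ n₂ ℕ.+ n₁
      N≡N′ : N ≡ N′
      N≡N′ = reverse-sum n₁ n₂ n₃
      swap : ∀ M → summand n₁ n₂ n₃ M ≈ summand n₃ n₂ n₁ M
      swap M = *-cong (*-congˡ (solve 3 (λ x y z → x :* y :* z := z :* y :* x) refl _ _ _))
        (reflexive (≡.cong (λ k → η k (M ℕ.* 2)) N≡N′))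

    predecessor : (ℕ → Carrier) → ℕ → Carrier
    predecessor f zero    = 0#
    predecessor f (suc n) = f n

    predecessor-cong : ∀ {f f′} n → (∀ i → f i ≈ f′ i) → predecessor f n ≈ predecessor f′ n
    predecessor-cong zero    f≈f′ = refl
    predecessor-cong (suc n) f≈f′ = f≈f′ n

    -- For positive n₁ the summands agree by computation. For n₁ = 0 the support would require n₂ ≤
    -- M, n₃ ≤ M and 2M < n₂ + n₃.
    S⁻-extend : ∀ n₁ n₂ n₃ {B} → n₁ ℕ.+ n₂ ℕ.+ n₃ < B →
      Σ< B (summand⁻ n₁ n₂ n₃) ≈ predecessor (λ n → S n n₂ n₃) n₁
    S⁻-extend (suc n₁) n₂ n₃ N<B = S-extend n₁ n₂ n₃ (ℕ.<-trans ℕ.≤-refl N<B)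
    S⁻-extend zero     n₂ n₃ {B} _ = Σ-zero B vanishes
      where
      vanishes : ∀ M → summand⁻ 0 n₂ n₃ M ≈ 0#
      vanishes M = begin
        P M * (ρ (suc M) 0 * ρ M n₂ * ρ M n₃) * η (n₂ ℕ.+ n₃) (suc (M ℕ.* 2))
          ≈⟨ *-assoc _ _ _ ⟩
        P M * (ρ (suc M) 0 * ρ M n₂ * ρ M n₃ * η (n₂ ℕ.+ n₃) (suc (M ℕ.* 2)))
          ≈⟨ support (suc M) 0 M n₂ n₃ (n₂ ℕ.+ n₃) (suc (M ℕ.* 2)) (λ _ n₂≤M n₃≤M 2M<n₂+n₃ →
               contradiction (ℕ.+-mono-≤ n₂≤M n₃≤M)
                 (ℕ.<⇒≱ (ℕ.≤-trans (s≤s (ℕ.≤-reflexive (m+m≡m*2 M))) 2M<n₂+n₃))) ⟩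
        0# * (ρ (suc M) 0 * ρ M n₂ * ρ M n₃ * η (n₂ ℕ.+ n₃) (suc (M ℕ.* 2)))
          ≈⟨ zeroˡ _ ⟩
        0#
          ∎

    -- The three-term operators: exchange of indices and adjointness.

    up down : ℕ → Carrier
    up   n = 1# - q * q ^ n
    down n = 1# - p * q ^ n

    -- J up down and J down up are adjoint; their eigenvectors for the eigenvalue -2x are
    -- (-1)ⁿ Qₙ / (q;q)ₙ and (-1)ⁿ Qₙ / (αβ;q)ₙ.
    J : (u d f : ℕ → Carrier) → ℕ → Carrier
    J u d f n = u n * f (suc n) + (- (s * q ^ n) * f n + predecessor (λ m → d m * f m) n)

    J-cong : ∀ {u d f f′} n → (∀ i → f i ≈ f′ i) → J u d f n ≈ J u d f′ n
    J-cong n f≈f′ = +-cong (*-congˡ (f≈f′ (suc n)))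
      (+-cong (*-congˡ (f≈f′ n)) (predecessor-cong n (λ i → *-congˡ (f≈f′ i))))

    predecessor-down : ∀ f n → predecessor (λ m → down m * f m) n ≈ (1# - p * q ^ (n ∸ 1)) * predecessor f n
    predecessor-down f zero    = sym (zeroʳ _)
    predecessor-down f (suc n) = refl

    -- Sums `recurrence-term` over M. Since `edge` vanishes at both ends of the range, its shift by
    -- one can be undone before `main+edge` is applied.
    J-S : ∀ n₁ n₂ n₃ → J up down (λ n → S n n₂ n₃) n₁
                     ≈ Σ< (2 ℕ.+ (n₁ ℕ.+ n₂ ℕ.+ n₃)) (Termwise.symmetric n₁ n₂ n₃)
    J-S n₁ n₂ n₃ = begin
      J up down (λ n → S n n₂ n₃) n₁
        ≈⟨ +-congˡ (+-congˡ (predecessor-down (λ n → S n n₂ n₃) n₁)) ⟩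
      (1# - q * t) * S (suc n₁) n₂ n₃
        + (- (s * t) * S n₁ n₂ n₃ + (1# - p * t⁻) * predecessor (λ n → S n n₂ n₃) n₁)
        ≈⟨ +-cong (*-congˡ (S-extend (suc n₁) n₂ n₃ {B} ℕ.≤-refl))
             (+-cong (*-congˡ (S-extend n₁ n₂ n₃ N<B)) (*-congˡ (S⁻-extend n₁ n₂ n₃ N<B))) ⟨
      (1# - q * t) * Σ< B (summand (suc n₁) n₂ n₃)
        + (- (s * t) * Σ< B (summand n₁ n₂ n₃) + (1# - p * t⁻) * Σ< B (summand⁻ n₁ n₂ n₃))
        ≈⟨ +-cong (Σ-*ˡ B _ _) (trans (Σ-+ B _ _) (+-cong (Σ-*ˡ B _ _) (Σ-*ˡ B _ _))) ⟨
      Σ< B (λ M → (1# - q * t) * summand (suc n₁) n₂ n₃ M)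
        + Σ< B (λ M → - (s * t) * summand n₁ n₂ n₃ M + (1# - p * t⁻) * summand⁻ n₁ n₂ n₃ M)
        ≈⟨ Σ-+ B _ _ ⟨
      Σ< B (λ M → (1# - q * t) * summand (suc n₁) n₂ n₃ M
        + (- (s * t) * summand n₁ n₂ n₃ M + (1# - p * t⁻) * summand⁻ n₁ n₂ n₃ M))
        ≈⟨ Σ-cong B recurrence-term ⟩
      Σ< B (λ M → main M + edge (suc M))
        ≈⟨ Σ-+ B main (edge ∘ suc) ⟩
      Σ< B main + Σ< B (edge ∘ suc)
        ≈⟨ +-congˡ (Σ-shift B edge edge-first (edge-last {B} (s≤s (s≤s (ℕ.m≤n⇒m≤1+n (ℕ.m≤n⇒m≤1+n (ℕ.m≤m*n N 2))))))) ⟩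
      Σ< B main + Σ< B edge
        ≈⟨ Σ-+ B main edge ⟨
      Σ< B (λ M → main M + edge M)
        ≈⟨ Σ-cong B main+edge ⟩
      Σ< B symmetric
        ∎
      where
      open Termwise n₁ n₂ n₃ hiding (t; t⁻)
      t t⁻ : Carrier
      t  = q ^ n₁
      t⁻ = q ^ (n₁ ∸ 1)
      -- A common range for all three sums: `S (suc n₁) n₂ n₃` is the longest and has exactly 2 + N
      -- terms.
      B : ℕ
      B = 2 ℕ.+ N
      N<B : N < B
      N<B = ℕ.m≤n⇒m≤1+n ℕ.≤-refl

    symmetric-swap : ∀ n₁ n₂ n₃ M → Termwise.symmetric n₁ n₂ n₃ M ≈ Termwise.symmetric n₃ n₂ n₁ M
    symmetric-swap n₁ n₂ n₃ M = *-cong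
      (*-cong (*-congˡ (solve 3 (λ x y z → x :* y :* z := z :* y :* x) refl _ _ _))
        (solve 4 (λ x y z w → 𝟏 :+ 𝟏 :- (x :+ y :+ z) :+ w := 𝟏 :+ 𝟏 :- (z :+ y :+ x) :+ w) refl _ _ _ _))
      (reflexive (≡.cong (λ k → η (suc k) (M ℕ.* 2)) (reverse-sum n₁ n₂ n₃)))

    J-S-swap : ∀ n₁ n₂ n₃ → J up down (λ n → S n n₂ n₃) n₁ ≈ J up down (S n₁ n₂) n₃
    J-S-swap n₁ n₂ n₃ = begin
      J up down (λ n → S n n₂ n₃) n₁
        ≈⟨ J-S n₁ n₂ n₃ ⟩
      Σ< (2 ℕ.+ (n₁ ℕ.+ n₂ ℕ.+ n₃)) (Termwise.symmetric n₁ n₂ n₃)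
        ≈⟨ Σ-cong _ (symmetric-swap n₁ n₂ n₃) ⟩
      Σ< (2 ℕ.+ (n₁ ℕ.+ n₂ ℕ.+ n₃)) (Termwise.symmetric n₃ n₂ n₁)
        ≡⟨ ≡.cong (λ k → Σ< (2 ℕ.+ k) (Termwise.symmetric n₃ n₂ n₁)) (reverse-sum n₁ n₂ n₃) ⟩
      Σ< (2 ℕ.+ (n₃ ℕ.+ n₂ ℕ.+ n₁)) (Termwise.symmetric n₃ n₂ n₁)
        ≈⟨ J-S n₃ n₂ n₁ ⟨
      J up down (λ n → S n n₂ n₁) n₃
        ≈⟨ J-cong {up} {down} n₃ (λ n → S-swap n n₂ n₁) ⟩
      J up down (S n₁ n₂) n₃
        ∎

    J-Σ : ∀ {u d} L (F : ℕ → ℕ → Carrier) (G : ℕ → Carrier) n →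
      J u d (λ n → Σ< L (λ m → F n m * G m)) n ≈ Σ< L (λ m → J u d (λ n → F n m) n * G m)
    J-Σ {u} {d} L F G n = begin
      u n * Σ< L (λ m → F (suc n) m * G m)
        + (- (s * q ^ n) * Σ< L (λ m → F n m * G m) + predecessor (λ k → d k * Σ< L (λ m → F k m * G m)) n)
        ≈⟨ +-cong (Σ-*ˡ L _ _) (+-cong (Σ-*ˡ L _ _) (predecessor-Σ n)) ⟨
      Σ< L (λ m → u n * (F (suc n) m * G m))
        + (Σ< L (λ m → - (s * q ^ n) * (F n m * G m)) + Σ< L (λ m → predecessor (λ k → d k * F k m) n * G m))
        ≈⟨ trans (Σ-+ L _ _) (+-congˡ (Σ-+ L _ _)) ⟨
      Σ< L (λ m → u n * (F (suc n) m * G m)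
        + (- (s * q ^ n) * (F n m * G m) + predecessor (λ k → d k * F k m) n * G m))
        ≈⟨ Σ-cong L (λ m → solve 6 (λ u f⁺ g t f f⁻ →
             u :* (f⁺ :* g) :+ (:- t :* (f :* g) :+ f⁻ :* g) := (u :* f⁺ :+ (:- t :* f :+ f⁻)) :* g)
             refl (u n) (F (suc n) m) (G m) (s * q ^ n) (F n m) _) ⟩
      Σ< L (λ m → J u d (λ n → F n m) n * G m)
        ∎
      where
      predecessor-Σ : ∀ n → Σ< L (λ m → predecessor (λ k → d k * F k m) n * G m)
                          ≈ predecessor (λ k → d k * Σ< L (λ m → F k m * G m)) n
      predecessor-Σ zero    = Σ-zero L (λ m → zeroˡ _)
      predecessor-Σ (suc n) = trans (Σ-cong L (λ m → *-assoc _ _ _)) (Σ-*ˡ L _ _)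

    -- Summation by parts. The lower boundary terms vanish through `predecessor`, and the upper ones
    -- involve only f at L and L + 1.
    J-adjoint : ∀ {u d} L f g → f L ≈ 0# → f (suc L) ≈ 0# →
      Σ< (suc L) (λ n → f n * J d u g n) ≈ Σ< (suc L) (λ n → J u d f n * g n)
    J-adjoint {u} {d} L f g fL≈0 f1+L≈0 = begin
      Σ< (suc L) (λ n → f n * J d u g n)
        ≈⟨ Σ-cong _ (λ n → solve 6 (λ f d g⁺ t g g⁻ →
             f :* (d :* g⁺ :+ (:- t :* g :+ g⁻)) := d :* f :* g⁺ :+ (:- t :* f :* g :+ f :* g⁻))
             refl (f n) (d n) (g (suc n)) (s * q ^ n) (g n) _) ⟩
      Σ< (suc L) (λ n → d n * f n * g (suc n)
        + (- (s * q ^ n) * f n * g n + f n * predecessor (λ m → u m * g m) n))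
        ≈⟨ trans (Σ-+ (suc L) _ _) (+-congˡ (Σ-+ (suc L) _ _)) ⟩
      Σ< (suc L) (λ n → d n * f n * g (suc n))
        + (Σ< (suc L) (λ n → - (s * q ^ n) * f n * g n)
          + Σ< (suc L) (λ n → f n * predecessor (λ m → u m * g m) n))
        ≈⟨ +-cong
             (Σ-shift (suc L) (λ n → predecessor (λ m → d m * f m) n * g n)
               (zeroˡ _) (trans (*-congʳ (trans (*-congˡ fL≈0) (zeroʳ _))) (zeroˡ _)))
             (+-congˡ (sym (Σ-shift (suc L) (λ n → f n * predecessor (λ m → u m * g m) n)
               (zeroʳ _) (trans (*-congʳ f1+L≈0) (zeroˡ _))))) ⟩
      Σ< (suc L) (λ n → predecessor (λ m → d m * f m) n * g n)
        + (Σ< (suc L) (λ n → - (s * q ^ n) * f n * g n) + Σ< (suc L) (λ n → f (suc n) * (u n * g n)))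
        ≈⟨ trans (Σ-+ (suc L) _ _) (+-congˡ (Σ-+ (suc L) _ _)) ⟨
      Σ< (suc L) (λ n → predecessor (λ m → d m * f m) n * g n
        + (- (s * q ^ n) * f n * g n + f (suc n) * (u n * g n)))
        ≈⟨ Σ-cong _ (λ n → solve 6 (λ f⁻ g t f f⁺ u →
             f⁻ :* g :+ (:- t :* f :* g :+ f⁺ :* (u :* g)) := (u :* f⁺ :+ (:- t :* f :+ f⁻)) :* g)
             refl _ (g n) (s * q ^ n) (f n) (f (suc n)) (u n)) ⟩
      Σ< (suc L) (λ n → J u d f n * g n)
        ∎

    -- `up n` divides the unit (q;q)_{n+1}, being its last factor.
    up-cancel : ∀ n {x y} → up n * x ≈ up n * y → x ≈ y
    up-cancel n {x} {y} ux≈uy = trans (sym (recover x)) (trans (*-congˡ ux≈uy) (recover y))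
      where
      recover : ∀ z → r (suc n) * ⟨ q ⨾ q ⟩ n * (up n * z) ≈ z
      recover z = begin
        r (suc n) * ⟨ q ⨾ q ⟩ n * (up n * z)    ≈⟨ solve 4 (λ a b c z → a :* b :* (c :* z) := a :* (b :* c) :* z) refl _ _ _ z ⟩
        r (suc n) * ⟨ q ⨾ q ⟩ (suc n) * z       ≈⟨ *-congʳ (proj₁ (proj₂ (q-invertible (suc n)))) ⟩
        1# * z                                  ≈⟨ *-identityˡ z ⟩
        z                                       ∎

    -- The initial case n₁ = 0.

    summand-zero-≢ : ∀ {n₂ n₃} M → n₂ ≢ M → summand 0 n₂ n₃ M ≈ 0#
    summand-zero-≢ {n₂} {n₃} M n₂≢M = summand-vanishes 0 n₂ n₃ λ _ n₂≤M n₃≤M 2M≤n₂+n₃ →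
      contradiction (ℕ.≤-trans (ℕ.≤-reflexive (m+m≡m*2 M)) 2M≤n₂+n₃)
        (ℕ.<⇒≱ (ℕ.+-mono-<-≤ (ℕ.≤∧≢⇒< n₂≤M n₂≢M) n₃≤M))

    -- On the support n₂ ≤ M, n₃ ≤ M and 2M ≤ n₂ + n₃, which forces n₂ = M = n₃.
    S-zero-≢ : ∀ {n₂ n₃} → n₃ ≢ n₂ → S 0 n₂ n₃ ≈ 0#
    S-zero-≢ {n₂} {n₃} n₃≢n₂ = Σ-zero _ vanishes
      where
      vanishes : ∀ M → summand 0 n₂ n₃ M ≈ 0#
      vanishes M with n₂ ℕ.≟ M
      ... | no  n₂≢M    = summand-zero-≢ M n₂≢M
      ... | yes ≡.refl  = summand-vanishes 0 n₂ n₃ λ _ _ n₃≤n₂ 2n₂≤n₂+n₃ →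
        contradiction (ℕ.≤-antisym n₃≤n₂
          (ℕ.+-cancelˡ-≤ n₂ n₂ n₃ (ℕ.≤-trans (ℕ.≤-reflexive (m+m≡m*2 n₂)) 2n₂≤n₂+n₃))) n₃≢n₂

    S-zero-≡ : ∀ n → S 0 n n ≈ P n * r n
    S-zero-≡ n = begin
      S 0 n n
        ≈⟨ Σ-single (summand 0 n n) (s≤s (ℕ.m≤m+n n n)) (λ M M≢n → summand-zero-≢ M (M≢n ∘ ≡.sym)) ⟩
      P n * (r n * ρ n n * ρ n n) * η (n ℕ.+ n) (n ℕ.* 2)
        ≈⟨ *-cong (*-congˡ (*-cong (*-congˡ ρ-diagonal) ρ-diagonal)) η-diagonal ⟩
      P n * (r n * 1# * 1#) * 1#
        ≈⟨ solve 2 (λ x y → x :* (y :* 𝟏 :* 𝟏) :* 𝟏 := x :* y) refl _ _ ⟩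
      P n * r n
        ∎
      where
      diagonal : ∀ f k → shift f k k ≡ f 0
      diagonal f k = ≡.trans (shift-≤ f (ℕ.≤-refl {k})) (≡.cong f (ℕ.n∸n≡0 k))
      ρ-diagonal : ρ n n ≈ 1#
      ρ-diagonal = trans (reflexive (diagonal r n)) r-zero
      η-diagonal : η (n ℕ.+ n) (n ℕ.* 2) ≈ 1#
      η-diagonal = trans
        (reflexive (≡.trans (≡.cong (λ k → η k (n ℕ.* 2)) (m+m≡m*2 n)) (diagonal h (n ℕ.* 2)))) h-zero

    -- Normalised polynomials as eigenvectors, and the induction on n₁.

    ε : Carrier
    ε = - 1#

    ε²ⁿ≈1 : ∀ n → ε ^ n * ε ^ n ≈ 1#
    ε²ⁿ≈1 zero    = *-identityˡ _
    ε²ⁿ≈1 (suc n) = trans (solve 1 (λ e → :- 𝟏 :* e :* (:- 𝟏 :* e) := e :* e) refl (ε ^ n)) (ε²ⁿ≈1 n)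

    module _ (x : Carrier) where

      𝑄 : ℕ → Carrier
      𝑄 = Q α β q x

      normalised : (ℕ → Carrier) → ℕ → Carrier
      normalised w n = ε ^ n * (w n * 𝑄 n)

      -- The recurrence of Q sees u and d only through their product, so both ways of splitting (1 -
      -- q^(n+1))(1 - p q^n) are covered; w absorbs the factor u.
      eigenvector : ∀ {u d} w → (∀ n → u n * w (suc n) ≈ w n) → (∀ n → u n * d n ≈ up n * down n) →
        ∀ n → J u d (normalised w) n ≈ - (x + x) * normalised w n
      eigenvector {u} {d} w uw≈w ud≈γ zero = begin
        u 0 * (ε * 1# * (w 1 * (x + x - s))) + (- (s * 1#) * (1# * (w 0 * 1#)) + 0#)
          ≈⟨ solve 5 (λ u w₁ w₀ x s →
               u :* (:- 𝟏 :* 𝟏 :* (w₁ :* (x :+ x :- s))) :+ (:- (s :* 𝟏) :* (𝟏 :* (w₀ :* 𝟏)) :+ 𝟎)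
               := :- (u :* w₁ :* (x :+ x :- s)) :- s :* w₀) refl (u 0) (w 1) (w 0) x s ⟩
        - (u 0 * w 1 * (x + x - s)) - s * w 0
          ≈⟨ +-congʳ (-‿cong (*-congʳ (uw≈w 0))) ⟩
        - (w 0 * (x + x - s)) - s * w 0
          ≈⟨ solve 3 (λ w₀ x s → :- (w₀ :* (x :+ x :- s)) :- s :* w₀ := :- (x :+ x) :* (𝟏 :* (w₀ :* 𝟏)))
               refl (w 0) x s ⟩
        - (x + x) * (1# * (w 0 * 1#))
          ∎
      eigenvector {u} {d} w uw≈w ud≈γ (suc m) = begin
        u n * (ε * (ε * e) * (w (suc n) * ((x + x - s * t) * 𝑄 n - up m * down m * 𝑄 m)))
          + (- (s * t) * (ε * e * (w n * 𝑄 n)) + d m * (e * (w m * 𝑄 m)))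
          ≈⟨ +-cong
               (trans
                 (solve 4 (λ u e w Z → u :* (:- 𝟏 :* (:- 𝟏 :* e) :* (w :* Z)) := e :* (u :* w) :* Z)
                   refl (u n) e (w (suc n)) _)
                 (*-cong (*-congˡ (uw≈w n)) (+-congˡ (-‿cong (*-congʳ (sym (ud≈γ m)))))))
               (+-congˡ (*-congˡ (*-congˡ (*-congʳ (sym (uw≈w m)))))) ⟩
        e * w n * ((x + x - s * t) * 𝑄 n - u m * d m * 𝑄 m)
          + (- (s * t) * (ε * e * (w n * 𝑄 n)) + d m * (e * (u m * w n * 𝑄 m)))
          ≈⟨ solve 9 (λ e w x s t Qₙ Qₘ u d →
               e :* w :* ((x :+ x :- s :* t) :* Qₙ :- u :* d :* Qₘ)
                 :+ (:- (s :* t) :* (:- 𝟏 :* e :* (w :* Qₙ)) :+ d :* (e :* (u :* w :* Qₘ)))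
               := :- (x :+ x) :* (:- 𝟏 :* e :* (w :* Qₙ)))
               refl e (w n) x s t (𝑄 n) (𝑄 m) (u m) (d m) ⟩
        - (x + x) * normalised w n
          ∎
        where
        n = suc m
        e = ε ^ m
        t = q ^ n

      Q̃ Q̂ : ℕ → Carrier
      Q̃ = normalised r
      Q̂ = normalised 1/⟨αβ⨾q⟩

      -- The range L stays fixed during the induction on n₁; the bound n₁ + n₂ < L keeps the
      -- boundary terms of `J-adjoint` zero at every stage.
      linearization : ∀ n₂ L n₁ → n₁ ℕ.+ n₂ < L → Σ< L (λ n₃ → S n₁ n₂ n₃ * Q̂ n₃) ≈ Q̃ n₁ * Q̃ n₂
      linearization n₂ L n₁ n₁+n₂<L = proj₁ (agree n₁ n₁+n₂<L)
        where
        Ψ Φ : ℕ → Carrier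
        Ψ n = Σ< L (λ n₃ → S n n₂ n₃ * Q̂ n₃)
        Φ n = Q̃ n * Q̃ n₂

        Φ-eigen : ∀ n → J up down Φ n ≈ - (x + x) * Φ n
        Φ-eigen n = begin
          J up down Φ n
            ≈⟨ factor n ⟩
          J up down Q̃ n * Q̃ n₂
            ≈⟨ *-congʳ (eigenvector {up} {down} r r-suc (λ _ → refl) n) ⟩
          - (x + x) * Q̃ n * Q̃ n₂
            ≈⟨ *-assoc _ _ _ ⟩
          - (x + x) * Φ n
            ∎
          where
          factor : ∀ n → J up down Φ n ≈ J up down Q̃ n * Q̃ n₂
          factor zero    = solve 5 (λ u f⁺ g t f →
            u :* (f⁺ :* g) :+ (:- t :* (f :* g) :+ 𝟎) := (u :* f⁺ :+ (:- t :* f :+ 𝟎)) :* g)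
            refl (up 0) (Q̃ 1) (Q̃ n₂) (s * 1#) (Q̃ 0)
          factor (suc m) = solve 7 (λ u f⁺ g t f d f⁻ →
            u :* (f⁺ :* g) :+ (:- t :* (f :* g) :+ d :* (f⁻ :* g))
            := (u :* f⁺ :+ (:- t :* f :+ d :* f⁻)) :* g)
            refl (up (suc m)) (Q̃ (suc (suc m))) (Q̃ n₂) (s * q ^ suc m) (Q̃ (suc m)) (down m) (Q̃ m)

        -- The operator moves from n to n₃ by `J-S-swap`, then from S to Q̂ by `J-adjoint`, where it
        -- acts as the scalar -2x.
        Ψ-eigen : ∀ n → suc n ℕ.+ n₂ < L → J up down Ψ n ≈ - (x + x) * Ψ n
        Ψ-eigen n (s≤s {n = L′} n+n₂<L′) = begin
          J up down Ψ n
            ≈⟨ J-Σ {up} {down} L (λ k n₃ → S k n₂ n₃) Q̂ n ⟩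
          Σ< L (λ n₃ → J up down (λ k → S k n₂ n₃) n * Q̂ n₃)
            ≈⟨ Σ-cong L (λ n₃ → *-congʳ (J-S-swap n n₂ n₃)) ⟩
          Σ< L (λ n₃ → J up down (S n n₂) n₃ * Q̂ n₃)
            ≈⟨ J-adjoint {up} {down} L′ (S n n₂) Q̂ (S-vanishes n n₂ L′ n+n₂<L′)
                 (S-vanishes n n₂ (suc L′) (ℕ.m≤n⇒m≤1+n n+n₂<L′)) ⟨
          Σ< L (λ n₃ → S n n₂ n₃ * J down up Q̂ n₃)
            ≈⟨ Σ-cong L (λ n₃ → trans (*-congˡ (eigenvector {down} {up} 1/⟨αβ⨾q⟩ 1/P-suc (λ _ → *-comm _ _) n₃))
                 (solve 3 (λ a b c → a :* (b :* c) := b :* (a :* c)) refl _ _ _)) ⟩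
          Σ< L (λ n₃ → - (x + x) * (S n n₂ n₃ * Q̂ n₃))
            ≈⟨ Σ-*ˡ L _ _ ⟩
          - (x + x) * Ψ n
            ∎

        Ψ₀≈Φ₀ : n₂ < L → Ψ 0 ≈ Φ 0
        Ψ₀≈Φ₀ n₂<L = begin
          Ψ 0
            ≈⟨ Σ-single _ n₂<L (λ n₃ n₃≢n₂ → trans (*-congʳ (S-zero-≢ n₃≢n₂)) (zeroˡ _)) ⟩
          S 0 n₂ n₂ * Q̂ n₂
            ≈⟨ *-congʳ (S-zero-≡ n₂) ⟩
          P n₂ * r n₂ * (ε ^ n₂ * (1/⟨αβ⨾q⟩ n₂ * 𝑄 n₂))
            ≈⟨ solve 5 (λ P r e P⁻¹ Q → P :* r :* (e :* (P⁻¹ :* Q)) := P :* P⁻¹ :* (𝟏 :* (𝟏 :* 𝟏) :* (e :* (r :* Q))))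
                 refl _ _ _ _ _ ⟩
          P n₂ * 1/⟨αβ⨾q⟩ n₂ * (1# * (1# * 1#) * Q̃ n₂)
            ≈⟨ *-cong (proj₂ (proj₂ (αβ-invertible n₂))) (*-congʳ (*-congˡ (*-congʳ (sym r-zero)))) ⟩
          1# * (Q̃ 0 * Q̃ n₂)
            ≈⟨ *-identityˡ _ ⟩
          Φ 0
            ∎

        -- The recurrence has order two, so the induction also carries the preceding value; at n = 0
        -- that component reads 0 ≈ 0.
        Agree : ℕ → Set ℓ
        Agree n = (Ψ n ≈ Φ n) × (predecessor (λ m → down m * Ψ m) n ≈ predecessor (λ m → down m * Φ m) n)

        agree : ∀ n → n ℕ.+ n₂ < L → Agree n
        agree zero    n₂<L     = Ψ₀≈Φ₀ n₂<L , refl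
        agree (suc n) 1+n+n₂<L = up-cancel n upΨ≈upΦ , *-congˡ Ψₙ≈Φₙ
          where
          ih : Agree n
          ih = agree n (ℕ.<-trans ℕ.≤-refl 1+n+n₂<L)
          Ψₙ≈Φₙ = proj₁ ih
          upf≈ : ∀ f → up n * f (suc n)
            ≈ J up down f n - (- (s * q ^ n) * f n + predecessor (λ m → down m * f m) n)
          upf≈ f = solve 2 (λ X Y → X := X :+ Y :- Y) refl _ _
          upΨ≈upΦ : up n * Ψ (suc n) ≈ up n * Φ (suc n)
          upΨ≈upΦ = begin
            up n * Ψ (suc n)
              ≈⟨ upf≈ Ψ ⟩
            J up down Ψ n - (- (s * q ^ n) * Ψ n + predecessor (λ m → down m * Ψ m) n)
              ≈⟨ +-cong (trans (Ψ-eigen n 1+n+n₂<L) (trans (*-congˡ Ψₙ≈Φₙ) (sym (Φ-eigen n))))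
                   (-‿cong (+-cong (*-congˡ Ψₙ≈Φₙ) (proj₂ ih))) ⟩
            J up down Φ n - (- (s * q ^ n) * Φ n + predecessor (λ m → down m * Φ m) n)
              ≈⟨ upf≈ Φ ⟨
            up n * Φ (suc n)
              ∎

    -- Identifying the linearization coefficient with S.

    module CoefficientSum (n₁ n₂ n₃ m₃ : ℕ) where

      M k : ℕ
      M = n₁ ℕ.+ m₃
      k = n₃ ℕ.+ n₂ ∸ (n₁ ℕ.+ 2 ℕ.* m₃)

      guarded : ℕ → Carrier
      guarded m₂ = if does (admissible? n₁ n₂ n₃ m₂ m₃) then term generic n₁ n₂ n₃ m₂ m₃ else 0#

      regroup : ∀ m₂ → n₁ ℕ.+ m₂ ℕ.+ 2 ℕ.* m₃ ≡ n₁ ℕ.+ 2 ℕ.* m₃ ℕ.+ m₂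
      regroup m₂ = solveℕ 3 (λ a b c → a ⊕ b ⊕ c ⊜ a ⊕ c ⊕ b) ≡.refl n₁ m₂ (2 ℕ.* m₃)

      bound : ∀ {m₂} → n₁ ℕ.+ m₂ ℕ.+ 2 ℕ.* m₃ ≤ n₃ ℕ.+ n₂ → m₂ ≤ k
      bound {m₂} fits = ℕ.m+n≤o⇒m≤o∸n m₂
        (ℕ.≤-trans (ℕ.≤-reflexive (≡.trans (ℕ.+-comm m₂ _) (≡.sym (regroup m₂)))) fits)

      guarded-no : ∀ m₂ → ¬ Admissible n₁ n₂ n₃ m₂ m₃ → guarded m₂ ≡ 0#
      guarded-no m₂ ¬adm = ≡.cong (λ b → if b then term generic n₁ n₂ n₃ m₂ m₃ else 0#)
        (dec-false (admissible? n₁ n₂ n₃ m₂ m₃) ¬adm)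

      guarded-yes : ∀ m₂ → Admissible n₁ n₂ n₃ m₂ m₃ → guarded m₂ ≡ term generic n₁ n₂ n₃ m₂ m₃
      guarded-yes m₂ adm = ≡.cong (λ b → if b then term generic n₁ n₂ n₃ m₂ m₃ else 0#)
        (dec-true (admissible? n₁ n₂ n₃ m₂ m₃) adm)

      -- Since M = n₁ + m₃, one n₁ cancels between the two arguments.
      η-index : η (n₁ ℕ.+ n₂ ℕ.+ n₃) (M ℕ.* 2) ≡ η (n₃ ℕ.+ n₂) (n₁ ℕ.+ 2 ℕ.* m₃)
      η-index = ≡.trans
        (≡.cong₂ η
          (solveℕ 3 (λ a b c → a ⊕ b ⊕ c ⊜ a ⊕ (c ⊕ b)) ≡.refl n₁ n₂ n₃)
          (solveℕ 2 (λ a m → (a ⊕ m) ⊗ κ 2 ⊜ a ⊕ (a ⊕ κ 2 ⊗ m)) ≡.refl n₁ m₃))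
        (shift-cancel h n₁ (n₃ ℕ.+ n₂) (n₁ ℕ.+ 2 ℕ.* m₃))

      all-inadmissible : (∀ m₂ → ¬ Admissible n₁ n₂ n₃ m₂ m₃) → summand n₁ n₂ n₃ M ≈ 0# →
        Σ< (suc (n₃ ℕ.+ n₂)) guarded ≈ summand n₁ n₂ n₃ M
      all-inadmissible ¬adm vanishes =
        trans (Σ-zero _ (λ m₂ → reflexive (guarded-no m₂ (¬adm m₂)))) (sym vanishes)

      commuted : ∀ {n} → n ≤ M → n ≤ m₃ ℕ.+ n₁
      commuted n≤M = ℕ.≤-trans n≤M (ℕ.≤-reflexive (ℕ.+-comm n₁ m₃))

      module _ (2M≤N : n₁ ℕ.+ 2 ℕ.* m₃ ≤ n₃ ℕ.+ n₂) (n₃≤M : n₃ ≤ m₃ ℕ.+ n₁) (n₂≤M : n₂ ≤ m₃ ℕ.+ n₁) where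

        w : Carrier
        w = P M * ρ³ M n₁ n₂ n₃

        ρ-value : ∀ {n} → n ≤ m₃ ℕ.+ n₁ → r (m₃ ℕ.+ n₁ ∸ n) ≈ ρ M n
        ρ-value {n} n≤M = reflexive (≡.trans (≡.sym (shift-≤ r n≤M)) (≡.cong (λ m → ρ m n) (ℕ.+-comm m₃ n₁)))

        ρ-self : r m₃ ≈ ρ M n₁
        ρ-self = trans (reflexive (≡.cong r (≡.sym (ℕ.m+n∸n≡m m₃ n₁)))) (ρ-value (ℕ.m≤n+m n₁ m₃))

        -- Once the conditions free of m₂ hold, admissibility amounts to m₂ ≤ k, which is the
        -- support of the shifted factor.
        guarded-term : ∀ m₂ → guarded m₂ ≈ w * (a α m₂ * shift (a β) k m₂)
        guarded-term m₂ with m₂ ℕ.≤? k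
        ... | no  m₂≰k = begin
          guarded m₂
            ≡⟨ guarded-no m₂ (λ adm → m₂≰k (bound (proj₁ adm))) ⟩
          0#
            ≈⟨ trans (*-congˡ (zeroʳ _)) (zeroʳ w) ⟨
          w * (a α m₂ * 0#)
            ≡⟨ ≡.cong (λ z → w * (a α m₂ * z)) (shift-< (a β) (ℕ.≰⇒> m₂≰k)) ⟨
          w * (a α m₂ * shift (a β) k m₂)
            ∎
        ... | yes m₂≤k = begin
          guarded m₂
            ≡⟨ guarded-yes m₂ (admits , n₃≤M , n₂≤M) ⟩
          term generic n₁ n₂ n₃ m₂ m₃
            ≡⟨ ≡.cong (λ e → P M * α ^ m₂ * β ^ e * q ^ (m₂ C 2 ℕ.+ e C 2)
                 * (r e * r m₂ * r (m₃ ℕ.+ n₁ ∸ n₃) * r (m₃ ℕ.+ n₁ ∸ n₂) * r m₃)) e≡k∸m₂ ⟩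
          P M * α ^ m₂ * β ^ e * q ^ (m₂ C 2 ℕ.+ e C 2)
            * (r e * r m₂ * r (m₃ ℕ.+ n₁ ∸ n₃) * r (m₃ ℕ.+ n₁ ∸ n₂) * r m₃)
            ≈⟨ *-cong (*-congˡ (^-homo-* q (m₂ C 2) (e C 2)))
                 (*-cong (*-cong (*-congˡ (ρ-value n₃≤M)) (ρ-value n₂≤M)) ρ-self) ⟩
          P M * α ^ m₂ * β ^ e * (q ^ (m₂ C 2) * q ^ (e C 2))
            * (r e * r m₂ * ρ M n₃ * ρ M n₂ * ρ M n₁)
            ≈⟨ solve 10 (λ P A B x y re rm ρ₃ ρ₂ ρ₁ →
                 P :* A :* B :* (x :* y) :* (re :* rm :* ρ₃ :* ρ₂ :* ρ₁)
                 := P :* (ρ₁ :* ρ₂ :* ρ₃) :* (A :* x :* rm :* (B :* y :* re)))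
                 refl _ _ _ _ _ _ _ _ _ _ ⟩
          w * (a α m₂ * a β e)
            ≡⟨ ≡.cong (λ z → w * (a α m₂ * z)) (shift-≤ (a β) m₂≤k) ⟨
          w * (a α m₂ * shift (a β) k m₂)
            ∎
          where
          e : ℕ
          e = k ∸ m₂
          e≡k∸m₂ : n₃ ℕ.+ n₂ ∸ (n₁ ℕ.+ m₂ ℕ.+ 2 ℕ.* m₃) ≡ e
          e≡k∸m₂ = ≡.trans (≡.cong (n₃ ℕ.+ n₂ ∸_) (regroup m₂))
            (≡.sym (ℕ.∸-+-assoc (n₃ ℕ.+ n₂) (n₁ ℕ.+ 2 ℕ.* m₃) m₂))
          admits : n₁ ℕ.+ m₂ ℕ.+ 2 ℕ.* m₃ ≤ n₃ ℕ.+ n₂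
          admits = ℕ.≤-trans (ℕ.≤-reflexive (regroup m₂))
            (ℕ.≤-trans (ℕ.+-monoʳ-≤ (n₁ ℕ.+ 2 ℕ.* m₃) m₂≤k) (ℕ.≤-reflexive (ℕ.m+[n∸m]≡n 2M≤N)))

        admissible-sum : Σ< (suc (n₃ ℕ.+ n₂)) guarded ≈ summand n₁ n₂ n₃ M
        admissible-sum = begin
          Σ< (suc (n₃ ℕ.+ n₂)) guarded
            ≈⟨ Σ-cong _ guarded-term ⟩
          Σ< (suc (n₃ ℕ.+ n₂)) (λ m₂ → w * (a α m₂ * shift (a β) k m₂))
            ≈⟨ Σ-*ˡ _ w _ ⟩
          w * Σ< (suc (n₃ ℕ.+ n₂)) (λ m₂ → a α m₂ * shift (a β) k m₂)
            ≈⟨ *-congˡ (conv-extend (a α) (a β) (s≤s (ℕ.m∸n≤m (n₃ ℕ.+ n₂) (n₁ ℕ.+ 2 ℕ.* m₃)))) ⟩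
          w * h k
            ≡⟨ ≡.cong (w *_) (≡.trans η-index (shift-≤ h 2M≤N)) ⟨
          summand n₁ n₂ n₃ M
            ∎

      -- For fixed m₃ the sum over m₂ is the convolution defining h.
      inner-sum : Σ< (suc (n₃ ℕ.+ n₂)) guarded ≈ summand n₁ n₂ n₃ M
      inner-sum with n₁ ℕ.+ 2 ℕ.* m₃ ℕ.≤? n₃ ℕ.+ n₂ | n₃ ℕ.≤? m₃ ℕ.+ n₁ | n₂ ℕ.≤? m₃ ℕ.+ n₁
      ... | yes 2M≤N | yes n₃≤M | yes n₂≤M = admissible-sum 2M≤N n₃≤M n₂≤M
      ... | no  2M≰N | _        | _        = all-inadmissible
        (λ m₂ adm → 2M≰N (ℕ.m+n≤o⇒m≤o _ (ℕ.≤-trans (ℕ.≤-reflexive (≡.sym (regroup m₂))) (proj₁ adm))))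
        (trans (*-congˡ (reflexive (≡.trans η-index (shift-< h (ℕ.≰⇒> 2M≰N))))) (zeroʳ _))
      ... | yes _    | no  n₃≰M | _        = all-inadmissible (λ m₂ adm → n₃≰M (proj₁ (proj₂ adm)))
        (summand-vanishes n₁ n₂ n₃ λ _ _ n₃≤M _ → contradiction (commuted n₃≤M) n₃≰M)
      ... | yes _    | yes _    | no  n₂≰M = all-inadmissible (λ m₂ adm → n₂≰M (proj₂ (proj₂ adm)))
        (summand-vanishes n₁ n₂ n₃ λ _ n₂≤M _ _ → contradiction (commuted n₂≤M) n₂≰M)

    -- After the sums are interchanged, m₃ indexes the terms M = n₁ + m₃ of S. The terms with M < n₁
    -- vanish, and the upper ends of the two ranges coincide.
    coefficient-S : ∀ n₁ n₂ n₃ → coefficient generic n₁ n₂ n₃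
      ≈ ε ^ (n₁ ℕ.+ n₂ ℕ.+ n₃) * (⟨ q ⨾ q ⟩ n₁ * ⟨ q ⨾ q ⟩ n₂ * 1/⟨αβ⨾q⟩ n₃) * S n₁ n₂ n₃
    coefficient-S n₁ n₂ n₃ = *-congˡ (begin
      _
        ≈⟨ Σ-comm (suc K) (suc K) (λ m₂ m₃ → guarded m₃ m₂) ⟩
      Σ< (suc K) (λ m₃ → Σ< (suc K) (guarded m₃))
        ≈⟨ Σ-cong (suc K) (CoefficientSum.inner-sum n₁ n₂ n₃) ⟩
      Σ< (suc K) (λ m₃ → summand n₁ n₂ n₃ (n₁ ℕ.+ m₃))
        ≈⟨ Σ-drop n₁ (suc K) (summand n₁ n₂ n₃) (λ M M<n₁ → summand-vanishes n₁ n₂ n₃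
             (λ n₁≤M _ _ _ → contradiction n₁≤M (ℕ.<⇒≱ M<n₁))) ⟨
      Σ< (n₁ ℕ.+ suc K) (summand n₁ n₂ n₃)
        ≡⟨ ≡.cong (λ B → Σ< B (summand n₁ n₂ n₃))
             (solveℕ 3 (λ a b c → a ⊕ (κ 1 ⊕ (c ⊕ b)) ⊜ κ 1 ⊕ (a ⊕ b ⊕ c)) ≡.refl n₁ n₂ n₃) ⟩
      S n₁ n₂ n₃
        ∎)
      where
      open CoefficientSum n₁ n₂ n₃ using (guarded)
      K : ℕ
      K = n₃ ℕ.+ n₂

    -- Removing the normalisation.

    module _ (x : Carrier) (n₁ n₂ : ℕ) where

      -- The inverse of the normalising factors of `Q̃ x n₁` and `Q̃ x n₂`; the signs are their own
      -- inverses.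
      scale : Carrier
      scale = ε ^ n₁ * ε ^ n₂ * (⟨ q ⨾ q ⟩ n₁ * ⟨ q ⨾ q ⟩ n₂)

      coefficient-Q : ∀ n₃ → coefficient generic n₁ n₂ n₃ * Q α β q x n₃ ≈ scale * (S n₁ n₂ n₃ * Q̂ x n₃)
      coefficient-Q n₃ = begin
        coefficient generic n₁ n₂ n₃ * Q α β q x n₃
          ≈⟨ *-congʳ (coefficient-S n₁ n₂ n₃) ⟩
        ε ^ (n₁ ℕ.+ n₂ ℕ.+ n₃) * (⟨ q ⨾ q ⟩ n₁ * ⟨ q ⨾ q ⟩ n₂ * 1/⟨αβ⨾q⟩ n₃) * S n₁ n₂ n₃ * Q α β q x n₃
          ≈⟨ *-congʳ (*-congʳ (*-congʳ (trans (^-homo-* ε (n₁ ℕ.+ n₂) n₃) (*-congʳ (^-homo-* ε n₁ n₂))))) ⟩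
        ε ^ n₁ * ε ^ n₂ * ε ^ n₃ * (⟨ q ⨾ q ⟩ n₁ * ⟨ q ⨾ q ⟩ n₂ * 1/⟨αβ⨾q⟩ n₃) * S n₁ n₂ n₃ * Q α β q x n₃
          ≈⟨ solve 7 (λ e₁₂ e₃ a₁ a₂ b₃ S Q → e₁₂ :* e₃ :* (a₁ :* a₂ :* b₃) :* S :* Q
               := e₁₂ :* (a₁ :* a₂) :* (S :* (e₃ :* (b₃ :* Q)))) refl _ _ _ _ _ _ _ ⟩
        scale * (S n₁ n₂ n₃ * Q̂ x n₃)
          ∎

      scale-Q̃ : scale * (Q̃ x n₁ * Q̃ x n₂) ≈ Q α β q x n₁ * Q α β q x n₂
      scale-Q̃ = begin
        scale * (Q̃ x n₁ * Q̃ x n₂)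
          ≈⟨ solve 8 (λ e₁ e₂ a₁ a₂ r₁ r₂ Q₁ Q₂ →
               e₁ :* e₂ :* (a₁ :* a₂) :* (e₁ :* (r₁ :* Q₁) :* (e₂ :* (r₂ :* Q₂)))
               := (e₁ :* e₁) :* (e₂ :* e₂) :* ((a₁ :* r₁) :* (a₂ :* r₂)) :* (Q₁ :* Q₂))
               refl _ _ _ _ _ _ _ _ ⟩
        (ε ^ n₁ * ε ^ n₁) * (ε ^ n₂ * ε ^ n₂) * ((⟨ q ⨾ q ⟩ n₁ * r n₁) * (⟨ q ⨾ q ⟩ n₂ * r n₂))
          * (Q α β q x n₁ * Q α β q x n₂)
          ≈⟨ *-congʳ (*-cong (*-cong (ε²ⁿ≈1 n₁) (ε²ⁿ≈1 n₂))
               (*-cong (proj₂ (proj₂ (q-invertible n₁))) (proj₂ (proj₂ (q-invertible n₂))))) ⟩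
        1# * 1# * (1# * 1#) * (Q α β q x n₁ * Q α β q x n₂)
          ≈⟨ solve 1 (λ z → 𝟏 :* 𝟏 :* (𝟏 :* 𝟏) :* z := z) refl _ ⟩
        Q α β q x n₁ * Q α β q x n₂
          ∎

      product-expansion :
        HasFiniteSum (λ n₃ → coefficient generic n₁ n₂ n₃ * Q α β q x n₃) (Q α β q x n₁ * Q α β q x n₂)
      -- By `S-vanishes` no term with n₃ > n₁ + n₂ survives; this is also the least range that
      -- `linearization` admits.
      product-expansion = suc (n₁ ℕ.+ n₂) , vanishes , (begin
        _
          ≡⟨ Σ-def (suc (n₁ ℕ.+ n₂)) (λ n₃ → coefficient generic n₁ n₂ n₃ * Q α β q x n₃) ⟩
        Σ< (suc (n₁ ℕ.+ n₂)) (λ n₃ → coefficient generic n₁ n₂ n₃ * Q α β q x n₃)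
          ≈⟨ trans (Σ-cong _ coefficient-Q) (Σ-*ˡ _ scale _) ⟩
        scale * Σ< (suc (n₁ ℕ.+ n₂)) (λ n₃ → S n₁ n₂ n₃ * Q̂ x n₃)
          ≈⟨ *-congˡ (linearization x n₂ (suc (n₁ ℕ.+ n₂)) n₁ ℕ.≤-refl) ⟩
        scale * (Q̃ x n₁ * Q̃ x n₂)
          ≈⟨ scale-Q̃ ⟩
        Q α β q x n₁ * Q α β q x n₂
          ∎)
        where
        vanishes : ∀ n → n₁ ℕ.+ n₂ < n → coefficient generic n₁ n₂ n * Q α β q x n ≈ 0#
        vanishes n n₁+n₂<n = begin
          coefficient generic n₁ n₂ n * Q α β q x n    ≈⟨ coefficient-Q n ⟩
          scale * (S n₁ n₂ n * Q̂ x n)                  ≈⟨ *-congˡ (*-congʳ (S-vanishes n₁ n₂ n n₁+n₂<n)) ⟩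
          scale * (0# * Q̂ x n)                         ≈⟨ trans (*-congˡ (zeroˡ _)) (zeroʳ _) ⟩
          0#                                           ∎

theorem1 : ∀ {c ℓ} (R : CommutativeRing c ℓ) →
    let open CommutativeRing R
        open AlSalamChihara R
    in (α β q x : Carrier) (generic : Generic α β q) (n₁ n₂ : ℕ) →
       HasFiniteSum
         (λ n₃ → coefficient generic n₁ n₂ n₃ * Q α β q x n₃)
         (Q α β q x n₁ * Q α β q x n₂)
theorem1 R α β q x generic n₁ n₂ = Linearization.product-expansion R generic x n₁ n₂
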